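{- Let $G=(V,E)$ be a finite simple undirected graph and let $\ell>0$ be an integer. For $v\in V$, let $\mathcal{T}_{v,\ell}$ be the set of subtrees of $G$ with exactly $\ell$ vertices that contain $v$. For a subgraph $H$ of $G$, let $r(H)=|\mathcal{R}(H)|$ be the number of relaxed legal configurations on $H$, and for $T\in\mathcal{T}_{v,\ell}$ let $G-T$ denote the graph obtained from $G$ by deleting the vertices of $T$. Then the number of pairs $(C,v)\in\mathcal{R}(G)\times V$ such that seeding $C$ at $v$ results in a burn-off game of length $\ell$ equals $$\sum_{v\in V}\ \sum_{T\in\mathcal{T}_{v,\ell}} r(G-T).$$
   Context: A (chip) configuration on a graph $H$ is a function $C\colon V(H)\to\mathbb{N}$. A vertex $v$ can fire if $C(v)>\deg_H(v)$; firing $v$ decreases $C(v)$ by $\deg_H(v)+1$ and increases $C(u)$ by $1$ for every neighbor $u$ of $v$. A configuration is relaxed if no vertex can fire. A configuration is supercritical if $C(v)>\deg_H(v)$ for every vertex $v$. Reverse-firing $v$ in $C'$ is allowed only when every neighbor $u$ of $v$ has $C'(u)\ge 1$; it increases $C'(v)$ by $\deg_H(v)+1$ and decreases each neighbor's count by $1$. A configuration is legal if some sequence of reverse-firings takes it to a supercritical configuration. $\mathcal{R}(H)$ is the set of relaxed legal configurations on $H$ (when $H$ has no vertices, $\mathcal{R}(H)$ consists of the single empty configuration, so $r(H)=1$). Seeding a relaxed configuration $C$ on $G$ at $v$ means passing to $C+\mathbf{1}_v$ (adding one chip to $v$) and then repeatedly firing vertices that can fire until a relaxed configuration is reached; the length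 of this burn-off game is the total number of vertex firings (this number, and the final configuration, do not depend on the order of firings). -}

module Defs where

open import Data.Nat using (ℕ; zero; suc; _+_; _∸_; _≤_; _<_)
open import Data.Bool using (Bool; true; false; _∧_; if_then_else_)
open import Data.Fin using (Fin; _≟_)
open import Data.Fin.Subset using (Subset; ⊤; ∁; ∣_∣)
open import Data.Vec using (Vec; lookup; tabulate; _[_]%=_)
open import Data.List using (List; []; _∷_; _++_; [_]; length; map; allFin)
open import Data.Nat.ListAction using (sum)
open import Data.List.Relation.Unary.Unique.Propositional using (Unique)
open import Data.List.Membership.Propositional using (_∈_)
open import Data.Product using (Σ; _×_; _,_; proj₁)
open import Data.Empty using (⊥)
open import Data.Unit using () renaming (⊤ to Unit)
open import Relation.Nullary using (¬_; does)
open import Relation.Binary.PropositionalEquality using (_≡_)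
open import Function.Bundles using (_⇔_)

record Graph (n : ℕ) : Set where
  field
    adj    : Fin n → Fin n → Bool
    sym    : ∀ u w → adj u w ≡ adj w u
    irrefl : ∀ u → adj u u ≡ false
open Graph public

module _ {n : ℕ} (G : Graph n) where

  -- Subgraphs of G induced on a vertex set W (a subset of V = Fin n).
  -- A configuration on the induced subgraph G[W] is represented by a
  -- vector C : Vec ℕ n which vanishes outside W (see OnW).

  nbr : Subset n → Fin n → Fin n → Bool
  nbr W v u = lookup W u ∧ adj G v u

  deg : Subset n → Fin n → ℕ
  deg W v = sum (map (λ u → if nbr W v u then 1 else 0) (allFin n))

  OnW : Subset n → Vec ℕ n → Set
  OnW W C = ∀ v → lookup W v ≡ false → lookup C v ≡ 0

  CanFire : Subset n → Fin n → Vec ℕ n → Set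
  CanFire W v C = lookup W v ≡ true × deg W v < lookup C v

  fire : Subset n → Fin n → Vec ℕ n → Vec ℕ n
  fire W v C = tabulate λ u →
    if does (u ≟ v) then lookup C v ∸ suc (deg W v)
    else (if nbr W v u then suc (lookup C u) else lookup C u)

  Relaxed : Subset n → Vec ℕ n → Set
  Relaxed W C = OnW W C × (∀ v → lookup W v ≡ true → lookup C v ≤ deg W v)

  Supercritical : Subset n → Vec ℕ n → Set
  Supercritical W C = ∀ v → lookup W v ≡ true → deg W v < lookup C v

  CanReverseFire : Subset n → Fin n → Vec ℕ n → Set
  CanReverseFire W v C =
    lookup W v ≡ true × (∀ u → nbr W v u ≡ true → 1 ≤ lookup C u)

  reverseFire : Subset n → Fin n → Vec ℕ n → Vec ℕ n
  reverseFire W v C = tabulate λ u →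
    if does (u ≟ v) then lookup C v + suc (deg W v)
    else (if nbr W v u then lookup C u ∸ 1 else lookup C u)

  data ReachesSupercritical (W : Subset n) : Vec ℕ n → Set where
    done : ∀ {C} → Supercritical W C → ReachesSupercritical W C
    step : ∀ {C} v → CanReverseFire W v C →
           ReachesSupercritical W (reverseFire W v C) →
           ReachesSupercritical W C

  Legal : Subset n → Vec ℕ n → Set
  Legal W C = OnW W C × ReachesSupercritical W C

  RelaxedLegal : Subset n → Vec ℕ n → Set
  RelaxedLegal W C = Relaxed W C × Legal W C

  data Fires (W : Subset n) : Vec ℕ n → ℕ → Vec ℕ n → Set where
    nil  : ∀ {C} → Fires W C 0 C
    cons : ∀ {C k D} v → CanFire W v C → Fires W (fire W v C) k D →
           Fires W C (suc k) D

  BurnOffLength : Vec ℕ n → Fin n → ℕ → Set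
  BurnOffLength C v ℓ =
    Σ (Vec ℕ n) λ D → Relaxed ⊤ D × Fires ⊤ (C [ v ]%= suc) ℓ D

  -- Subtrees of G: a vertex set S and a (symmetric) edge set F ⊆ E(G)
  -- with both endpoints of every edge in S.

  SubgraphData : Set
  SubgraphData = Subset n × Vec (Vec Bool n) n

  module _ (F : Vec (Vec Bool n) n) where
    E : Fin n → Fin n → Set
    E u w = lookup (lookup F u) w ≡ true

    data Reach : Fin n → Fin n → Set where
      here  : ∀ {u} → Reach u u
      there : ∀ {u x w} → E u x → Reach x w → Reach u w

    Linked : List (Fin n) → Set
    Linked []           = Unit
    Linked (x ∷ [])     = Unit
    Linked (x ∷ y ∷ ys) = E x y × Linked (y ∷ ys)

    HasCycle : Set
    HasCycle = Σ (Fin n) λ x → Σ (List (Fin n)) λ ys →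
      2 ≤ length ys × Unique (x ∷ ys) × Linked (x ∷ ys ++ [ x ])

  IsSubtreeAt : ℕ → Fin n → SubgraphData → Set
  IsSubtreeAt ℓ v (S , F) =
    (∀ u w → E F u w → adj G u w ≡ true × lookup S u ≡ true × lookup S w ≡ true)
    × (∀ u w → lookup (lookup F u) w ≡ lookup (lookup F w) u)
    × (∀ u w → lookup S u ≡ true → lookup S w ≡ true → Reach F u w)
    × ¬ HasCycle F
    × ∣ S ∣ ≡ ℓ
    × lookup S v ≡ true

Enumerates : {A : Set} → (A → Set) → List A → Set
Enumerates {A} P xs = Unique xs × (∀ a → P a ⇔ a ∈ xs)

HasSize : {A : Set} → (A → Set) → ℕ → Set
HasSize {A} P k = Σ (List A) λ xs → Enumerates P xs × length xs ≡ k

{-# OPTIONS --safe #-}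
module Submission where

-- No vertex fires twice, so a burn-off game is determined by the set S of fired
-- vertices, which is connected and contains v.  Off S, relaxedness of the result
-- says exactly that C restricts to a relaxed configuration on G - S.  A configuration
-- is legal iff every nonempty A contains a vertex u with C(u) ≥ deg_A(u); since S
-- burns on its own, C is legal on G iff its restriction is legal on G - S.
-- On S, Dhar's burning algorithm matches the configurations with the spanning trees
-- of G[S]: fire one vertex at a time, in an order depending only on the set of
-- vertices able to fire.  The parent of u is the vertex whose firing makes u able to
-- fire.  Conversely, exploring a tree in the same order gives the number of fired
-- neighbours of u when its parent has fired, hence the number of chips at u.

open import Defs
open import Data.Nat using (ℕ; _>_; _+_)
open import Data.Fin using (Fin)
open import Data.Fin.Subset using (Subset; ⊤; ∁)
open import Data.Vec using (Vec)
open import Data.List using (List; map; allFin)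
open import Data.Nat.ListAction using (sum)
open import Data.Product using (Σ; _×_; _,_; proj₁)
open import Data.Nat using (zero; suc; _∸_; _≤_; _<_; z≤n; s≤s; _<?_)
open import Data.Nat.Properties hiding (_≟_)
open import Data.Bool using (Bool; true; false; _∧_; _∨_; not; if_then_else_)
open import Data.Bool.Properties
  using (∧-conicalˡ; ∧-conicalʳ; ∨-zeroʳ; ∨-comm; ¬-not; not-¬)
  renaming (_≟_ to _≟ᵇ_)
open import Data.Fin using (zero; suc; _≟_)
open import Data.Fin.Properties using (any?)
open import Data.Fin.Subset using (⊥; ∣_∣)
open import Data.Fin.Subset.Properties using (∣p∣≤n; ∣p∣≡n⇒p≡⊤; ∣⊥∣≡0)
open import Data.Vec using ([]; _∷_; lookup; tabulate; _[_]≔_; _[_]%=_)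
open import Data.Vec.Properties
  using (lookup∘tabulate; tabulate∘lookup; tabulate-cong; lookup-replicate; lookup-map;
         lookup∘update; lookup∘update′; lookup∘updateAt; lookup∘updateAt′)
open import Data.List using ([]; _∷_; _++_; [_]; length; concatMap)
import Data.List as List
open import Data.List.Properties using (map-tabulate; map-cong; length-++; length-map)
open import Data.List.Membership.Propositional using (_∈_; _∉_; find; lose)
open import Data.List.Membership.DecPropositional using (_∈?_)
open import Data.List.Membership.Propositional.Properties
  using (∈-allFin; ∈-concatMap⁺; ∈-concatMap⁻; ∈-map⁺; ∈-map⁻)
open import Data.List.Relation.Unary.All using (All; []; _∷_)
import Data.List.Relation.Unary.All as All
open import Data.List.Relation.Unary.All.Properties using (¬Any⇒All¬) renaming (map⁺ to All-map⁺)
open import Data.List.Relation.Unary.AllPairs using ([]; _∷_)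
open import Data.List.Relation.Unary.Any using (here; there)
open import Data.List.Relation.Unary.Unique.Propositional using (Unique)
open import Data.List.Relation.Unary.Unique.Propositional.Properties
  using (allFin⁺) renaming (++⁺ to unique-++⁺)
open import Data.Product using (∃; proj₂)
open import Data.Sum using (_⊎_; inj₁; inj₂)
open import Data.Unit using (tt) renaming (⊤ to Unit)
open import Function using (_∘_; id)
open import Function.Bundles using (mk⇔; Equivalence)
open import Relation.Nullary using (¬_; Dec; yes; no; does; contradiction)
open import Relation.Nullary.Decidable using (dec-true; dec-false; _×-dec_; _⊎-dec_)
open import Relation.Binary.PropositionalEquality
  using (_≡_; _≢_; refl; cong; cong₂; subst; trans; module ≡-Reasoning)
  renaming (sym to ≡-sym)
open import Relation.Binary.Construct.Closure.ReflexiveTransitive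
  using (Star; ε; _◅_; _◅◅_; reverse)

-- The operators `burn` and `spread` need not agree on arbitrary sets, so they are compared only on
-- the sets actually visited. Since `grow` picks the next vertex from the operator's value and the
-- current set alone, agreement there forces the two explorations to coincide step by step, and with
-- them the levels, the parents and the trees. This makes the two directions mutually inverse.
-- Firing one vertex per step is what makes chips recoverable: the number of fired neighbours of a
-- vertex then rises by at most one per step, so the vertex reaches its threshold with no chip to
-- spare, and its chip count is determined by the step at which this happens. Firing all able
-- vertices at once would leave several possible values and several possible parents.

does-true : ∀ {A : Set} (d : Dec A) → does d ≡ true → A
does-true (yes a) _ = a

∨-true : ∀ a {b} → a ∨ b ≡ true → a ≡ true ⊎ b ≡ true
∨-true true  p = inj₁ refl
∨-true false p = inj₂ p

bool-ext : ∀ {a b} → (a ≡ true → b ≡ true) → (b ≡ true → a ≡ true) → a ≡ b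
bool-ext {true}  {b}     f g = ≡-sym (f refl)
bool-ext {false} {true}  f g = g refl
bool-ext {false} {false} f g = refl

true≢false : ∀ {a} → a ≡ true → ¬ a ≡ false
true≢false = not-¬

lookup-ext : ∀ {A : Set} {n} {xs ys : Vec A n} →
             (∀ i → lookup xs i ≡ lookup ys i) → xs ≡ ys
lookup-ext {xs = xs} {ys} p =
  trans (≡-sym (tabulate∘lookup xs)) (trans (tabulate-cong p) (tabulate∘lookup ys))

-- Sums over Fin n

sum-map-mono : ∀ {A : Set} {f g : A → ℕ} (xs : List A) →
               (∀ x → f x ≤ g x) → sum (map f xs) ≤ sum (map g xs)
sum-map-mono []       p = z≤n
sum-map-mono (x ∷ xs) p = +-mono-≤ (p x) (sum-map-mono xs p)

sum-map-+ : ∀ {A : Set} {f g h : A → ℕ} (xs : List A) →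
            (∀ x → f x ≡ g x + h x) →
            sum (map f xs) ≡ sum (map g xs) + sum (map h xs)
sum-map-+ []       p = refl
sum-map-+ {f = f} {g} {h} (x ∷ xs) p = begin
  f x + sum (map f xs)                                ≡⟨ cong₂ _+_ (p x) (sum-map-+ xs p) ⟩
  (g x + h x) + (sum (map g xs) + sum (map h xs))     ≡⟨ +-assoc (g x) (h x) _ ⟩
  g x + (h x + (sum (map g xs) + sum (map h xs)))     ≡⟨ cong (g x +_) (+-comm (h x) _) ⟩
  g x + ((sum (map g xs) + sum (map h xs)) + h x)     ≡⟨ cong (g x +_) (+-assoc (sum (map g xs)) _ _) ⟩
  g x + (sum (map g xs) + (sum (map h xs) + h x))     ≡⟨ +-assoc (g x) _ _ ⟨
  (g x + sum (map g xs)) + (sum (map h xs) + h x)     ≡⟨ cong (g x + sum (map g xs) +_) (+-comm _ (h x)) ⟩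
  (g x + sum (map g xs)) + (h x + sum (map h xs))     ∎
  where open ≡-Reasoning

sum-tabulate-bump : ∀ {n} {f g : Fin n → ℕ} x a → g x ≡ f x + a →
                    (∀ w → w ≢ x → g w ≡ f w) →
                    sum (List.tabulate g) ≡ sum (List.tabulate f) + a
sum-tabulate-bump {suc n} {f} {g} zero a p q = begin
  g zero + sum (List.tabulate (g ∘ suc))       ≡⟨ cong₂ _+_ p (same (λ w → q (suc w) λ ())) ⟩
  f zero + a + sum (List.tabulate (f ∘ suc))   ≡⟨ +-assoc (f zero) a _ ⟩
  f zero + (a + sum (List.tabulate (f ∘ suc))) ≡⟨ cong (f zero +_) (+-comm a _) ⟩
  f zero + (sum (List.tabulate (f ∘ suc)) + a) ≡⟨ +-assoc (f zero) _ a ⟨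
  f zero + sum (List.tabulate (f ∘ suc)) + a   ∎
  where
  open ≡-Reasoning
  same : ∀ {m} {f g : Fin m → ℕ} → (∀ w → g w ≡ f w) →
         sum (List.tabulate g) ≡ sum (List.tabulate f)
  same {zero}  e = refl
  same {suc m} e = cong₂ _+_ (e zero) (same (e ∘ suc))
sum-tabulate-bump {suc n} {f} {g} (suc x) a p q = trans
  (cong₂ _+_ (q zero λ ())
             (sum-tabulate-bump x a p λ w w≢x → q (suc w) λ { refl → w≢x refl }))
  (≡-sym (+-assoc (f zero) _ a))

sum-allFin-bump : ∀ {n} {f g : Fin n → ℕ} x a → g x ≡ f x + a →
                  (∀ w → w ≢ x → g w ≡ f w) →
                  sum (map g (allFin n)) ≡ sum (map f (allFin n)) + a
sum-allFin-bump {f = f} {g} x a p q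
  rewrite map-tabulate id f | map-tabulate id g = sum-tabulate-bump x a p q

-- Subsets

infix 4 _⊑_

_⊑_ : ∀ {n} → Subset n → Subset n → Set
P ⊑ Q = ∀ u → lookup P u ≡ true → lookup Q u ≡ true

⊑-antisym : ∀ {n} {P Q : Subset n} → P ⊑ Q → Q ⊑ P → P ≡ Q
⊑-antisym p q = lookup-ext λ u → bool-ext (p u) (q u)

∉⊥ : ∀ {n} (u : Fin n) → ¬ lookup ⊥ u ≡ true
∉⊥ u p = true≢false p (lookup-replicate u false)

∈⊤ : ∀ {n} (u : Fin n) → lookup ⊤ u ≡ true
∈⊤ u = lookup-replicate u true

lookup-∁ : ∀ {n} (S : Subset n) u → lookup (∁ S) u ≡ not (lookup S u)
lookup-∁ S u = lookup-map u not S

insert : ∀ {n} → Fin n → Subset n → Subset n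
insert x P = P [ x ]≔ true

insert⁻ : ∀ {n} x (P : Subset n) u → lookup (insert x P) u ≡ true →
          u ≡ x ⊎ lookup P u ≡ true
insert⁻ x P u p with u ≟ x
... | yes e = inj₁ e
... | no u≢x = inj₂ (trans (≡-sym (lookup∘update′ u≢x P true)) p)

x∈insert : ∀ {n} x (P : Subset n) → lookup (insert x P) x ≡ true
x∈insert x P = lookup∘update x P true

insert⁺ : ∀ {n} x (P : Subset n) → P ⊑ insert x P
insert⁺ x P u p with u ≟ x
... | yes refl = x∈insert x P
... | no u≢x = trans (lookup∘update′ u≢x P true) p

insert-⊑ : ∀ {n} {x} {P Q : Subset n} → P ⊑ Q → lookup Q x ≡ true → insert x P ⊑ Q
insert-⊑ {x = x} {P} p q u r with insert⁻ x P u r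
... | inj₁ refl = q
... | inj₂ s = p u s

remove : ∀ {n} → Fin n → Subset n → Subset n
remove x P = P [ x ]≔ false

remove-⊑ : ∀ {n} x (P : Subset n) → remove x P ⊑ P
remove-⊑ x P u p with u ≟ x
... | yes refl = contradiction (lookup∘update x P false) (true≢false p)
... | no u≢x = trans (≡-sym (lookup∘update′ u≢x P false)) p

insert-remove : ∀ {n} x (P : Subset n) → lookup P x ≡ true → insert x (remove x P) ≡ P
insert-remove zero    (true ∷ P) refl = refl
insert-remove (suc x) (b ∷ P)    p    = cong (b ∷_) (insert-remove x P p)

∣insert∣ : ∀ {n} x (P : Subset n) → lookup P x ≡ false → ∣ insert x P ∣ ≡ suc ∣ P ∣
∣insert∣ zero    (false ∷ P) refl = refl
∣insert∣ (suc x) (true ∷ P)  p    = cong suc (∣insert∣ x P p)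
∣insert∣ (suc x) (false ∷ P) p    = ∣insert∣ x P p

-- Adds the least element of B outside P; any choice determined by B and P would do.
grow : ∀ {n} → Subset n → Subset n → Subset n
grow []          []          = []
grow (true ∷ B)  (false ∷ P) = true ∷ P
grow (true ∷ B)  (true ∷ P)  = true ∷ grow B P
grow (false ∷ B) (p ∷ P)     = p ∷ grow B P

data Growth {n} (B P : Subset n) : Subset n → Set where
  stuck : B ⊑ P → Growth B P P
  add   : ∀ x → lookup B x ≡ true → lookup P x ≡ false → Growth B P (insert x P)

grown : ∀ {n} (B P : Subset n) → Growth B P (grow B P)
grown []          []          = stuck λ ()
grown (true ∷ B)  (false ∷ P) = add zero refl refl
grown (true ∷ B)  (true ∷ P) with grow B P | grown B P
... | _ | stuck s   = stuck λ { zero _ → refl ; (suc u) → s u }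
... | _ | add x p q = add (suc x) p q
grown (false ∷ B) (p ∷ P) with grow B P | grown B P
... | _ | stuck s   = stuck λ { zero () ; (suc u) → s u }
... | _ | add x p q = add (suc x) p q

-- Thresholds of increasing Boolean sequences

-- Meant for increasing f; the value is k if f fails below k, even if f k fails.
first : (ℕ → Bool) → ℕ → ℕ
first f zero    = zero
first f (suc k) = if f k then first f k else suc k

Increasing : (ℕ → Bool) → Set
Increasing f = ∀ k → f k ≡ true → f (suc k) ≡ true

module _ {f : ℕ → Bool} where

  increasing-≤ : Increasing f → ∀ {j k} → j ≤ k → f j ≡ true → f k ≡ true
  increasing-≤ up {zero} {zero} z≤n p = p
  increasing-≤ up {j} {suc k} j≤k p with m≤n⇒m<n∨m≡n j≤k
  ... | inj₁ (s≤s j≤k′) = up k (increasing-≤ up j≤k′ p)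
  ... | inj₂ refl = p

  first-holds : ∀ k → f k ≡ true → f (first f k) ≡ true
  first-holds zero    p = p
  first-holds (suc k) p with f k in eq
  ... | true  = first-holds k eq
  ... | false = p

  first-≤ : Increasing f → ∀ k {j} → f j ≡ true → first f k ≤ j
  first-≤ up zero    p = z≤n
  first-≤ up (suc k) {j} p with f k in eq
  ... | true  = first-≤ up k p
  ... | false = ≰⇒> λ j≤k → true≢false (increasing-≤ up j≤k p) eq

  first≡suc : Increasing f → ∀ k {j} → f k ≡ true → f (suc j) ≡ true → f j ≡ false →
              first f k ≡ suc j
  first≡suc up k p q r = ≤-antisym (first-≤ up k q)
    (≰⇒> λ le → true≢false (increasing-≤ up le (first-holds k p)) r)

  -- A discrete intermediate value argument; the flip it locates is the step at which a parent
  -- enters.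
  switch : ∀ k → f k ≡ true →
           f 0 ≡ true ⊎ ∃ λ j → j < k × f j ≡ false × f (suc j) ≡ true
  switch zero    p = inj₁ p
  switch (suc k) p with f k in eq
  ... | false = inj₂ (k , ≤-refl , eq , p)
  ... | true with switch k eq
  ...   | inj₁ q = inj₁ q
  ...   | inj₂ (j , j<k , q) = inj₂ (j , m≤n⇒m≤1+n j<k , q)

first-cong : ∀ {f g : ℕ → Bool} → (∀ k → f k ≡ g k) → ∀ k → first f k ≡ first g k
first-cong e zero    = refl
first-cong e (suc k) rewrite e k | first-cong e k = refl

-- Exploration of a vertex set by a monotone operator

Monotone : ∀ {n} → (Subset n → Subset n) → Set
Monotone B = ∀ P Q → P ⊑ Q → B P ⊑ B Q

module Process {n : ℕ} (B : Subset n → Subset n) where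

  P : ℕ → Subset n
  P zero    = ⊥
  P (suc k) = grow (B (P k)) (P k)

  growth : ∀ k → Growth (B (P k)) (P k) (P (suc k))
  growth k = grown (B (P k)) (P k)

  lev : Fin n → ℕ
  lev u = first (λ k → lookup (B (P k)) u) n

  rank : Fin n → ℕ
  rank u = first (λ k → lookup (P k) u) n

  -- w is the parent of u when its entering the explored set brings u into B.
  parent : Fin n → Fin n → Bool
  parent u w = lookup (P n) u ∧ (lookup (P (lev u)) w ∧ not (lookup (P (lev u ∸ 1)) w))

  tree : Vec (Vec Bool n) n
  tree = tabulate λ u → tabulate λ w → parent u w ∨ parent w u

  lookup-tree : ∀ u w → lookup (lookup tree u) w ≡ parent u w ∨ parent w u
  lookup-tree u w = trans (cong (λ F → lookup F w) (lookup∘tabulate _ u)) (lookup∘tabulate _ w)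

  P-step : ∀ k → P k ⊑ P (suc k)
  P-step k u p with P (suc k) | growth k
  ... | _ | stuck _   = p
  ... | _ | add x _ _ = insert⁺ x (P k) u p

  P-mono : ∀ {j k} → j ≤ k → P j ⊑ P k
  P-mono j≤k u = increasing-≤ (λ i → P-step i u) j≤k

  P-suc⁻ : ∀ k u → lookup (P (suc k)) u ≡ true →
           lookup (P k) u ≡ true ⊎ lookup (B (P k)) u ≡ true
  P-suc⁻ k u p with P (suc k) | growth k
  ... | _ | stuck _   = inj₁ p
  ... | _ | add x q _ with insert⁻ x (P k) u p
  ...   | inj₁ refl = inj₂ q
  ...   | inj₂ r    = inj₁ r

  -- `grow` adds at most one vertex per step. Uniqueness of parents rests on this.
  new-unique : ∀ k {u w} → lookup (P (suc k)) u ≡ true → lookup (P k) u ≡ false →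
               lookup (P (suc k)) w ≡ true → lookup (P k) w ≡ false → u ≡ w
  new-unique k {u} {w} pu qu pw qw with P (suc k) | growth k
  ... | _ | stuck _   = contradiction qu (true≢false pu)
  ... | _ | add x _ _ with insert⁻ x (P k) u pu | insert⁻ x (P k) w pw
  ...   | inj₁ refl | inj₁ refl = refl
  ...   | inj₂ r    | _         = contradiction qu (true≢false r)
  ...   | _         | inj₂ r    = contradiction qw (true≢false r)

  P-suc-new : ∀ k {w} → lookup (P (suc k)) w ≡ true → lookup (P k) w ≡ false →
              P (suc k) ≡ insert w (P k)
  P-suc-new k {w} p q with P (suc k) | growth k
  ... | _ | stuck _   = contradiction q (true≢false p)
  ... | _ | add x _ _ with insert⁻ x (P k) w p
  ...   | inj₁ refl = refl
  ...   | inj₂ r    = contradiction q (true≢false r)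

  -- Together with `closed` this makes `P n` the least closed set of a monotone operator, whatever
  -- choices `grow` makes.
  P-least : ∀ Q → Monotone B → B Q ⊑ Q → ∀ k → P k ⊑ Q
  P-least Q mono closed zero    u p = contradiction p (∉⊥ u)
  P-least Q mono closed (suc k) u p with P-suc⁻ k u p
  ... | inj₁ q = P-least Q mono closed k u q
  ... | inj₂ q = closed u (mono (P k) Q (P-least Q mono closed k) u q)

  -- A step that is not stuck adds a vertex, and a stuck exploration stays stuck. Hence `n` steps
  -- are enough to reach a closed set.
  closed⊎large : ∀ k → B (P k) ⊑ P k ⊎ k ≤ ∣ P k ∣
  closed⊎large zero = inj₂ z≤n
  closed⊎large (suc k) with closed⊎large k | P (suc k) | growth k
  ... | inj₁ c | _ | stuck s    = inj₁ s
  ... | inj₁ c | _ | add x p q  = contradiction q (true≢false (c x p))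
  ... | inj₂ l | _ | stuck s    = inj₁ s
  ... | inj₂ l | _ | add x p q  = inj₂ (subst (suc k ≤_) (≡-sym (∣insert∣ x (P k) q)) (s≤s l))

  closed : B (P n) ⊑ P n
  closed u p with closed⊎large n
  ... | inj₁ c = c u p
  ... | inj₂ l = subst (λ Q → lookup Q u ≡ true)
                       (≡-sym (∣p∣≡n⇒p≡⊤ {p = P n} (≤-antisym (∣p∣≤n (P n)) l))) (∈⊤ u)

  module Mono (mono : Monotone B) where

    B-step : ∀ k → B (P k) ⊑ B (P (suc k))
    B-step k = mono (P k) (P (suc k)) (P-step k)

    B-mono : ∀ {j k} → j ≤ k → B (P j) ⊑ B (P k)
    B-mono {j} {k} j≤k = mono (P j) (P k) (P-mono j≤k)

    P⊑Pn : ∀ k → P k ⊑ P n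
    P⊑Pn = P-least (P n) mono closed

    -- A vertex enters from the operator's value at an earlier set, and monotonicity keeps it there.
    -- For `burn` this guarantees that the subtractions for fired vertices are exact.
    P⊑B : ∀ k → P k ⊑ B (P k)
    P⊑B zero    u p = contradiction p (∉⊥ u)
    P⊑B (suc k) u p with P-suc⁻ k u p
    ... | inj₁ q = B-step k u (P⊑B k u q)
    ... | inj₂ q = B-step k u q

    BP⊑Pn : ∀ k → B (P k) ⊑ P n
    BP⊑Pn k u p = closed u (mono (P k) (P n) (P⊑Pn k) u p)

    lev-holds : ∀ u → lookup (P n) u ≡ true → lookup (B (P (lev u))) u ≡ true
    lev-holds u p = first-holds {λ k → lookup (B (P k)) u} n (P⊑B n u p)

    lev-≤ : ∀ u {k} → lookup (B (P k)) u ≡ true → lev u ≤ k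
    lev-≤ u = first-≤ (λ k → B-step k u) n

    lev≡suc : ∀ u {j} → lookup (B (P (suc j))) u ≡ true → lookup (B (P j)) u ≡ false →
              lev u ≡ suc j
    lev≡suc u {j} p = first≡suc (λ k → B-step k u) n (P⊑B n u (BP⊑Pn (suc j) u p)) p

    <-not-∈ : ∀ {j k w} → lookup (P j) w ≡ true → lookup (P k) w ≡ false → k < j
    <-not-∈ {w = w} p q = ≰⇒> λ le → true≢false (P-mono le w p) q

    rank-holds : ∀ u → lookup (P n) u ≡ true → lookup (P (rank u)) u ≡ true
    rank-holds u = first-holds {λ k → lookup (P k) u} n

    rank-≤ : ∀ u {k} → lookup (P k) u ≡ true → rank u ≤ k
    rank-≤ u = first-≤ (λ k → P-step k u) n

    rank-positive : ∀ u → lookup (P n) u ≡ true → 0 < rank u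
    rank-positive u p with rank u | rank-holds u p
    ... | zero  | q = contradiction q (∉⊥ u)
    ... | suc _ | _ = s≤s z≤n

    rank-injective : ∀ {u w} → lookup (P n) u ≡ true → lookup (P n) w ≡ true →
                     rank u ≡ rank w → u ≡ w
    rank-injective {u} {w} p q e with rank u in eq | rank w in eq′ | rank-holds u p | rank-holds w q
    rank-injective {u} {w} p q refl | zero  | _ | h | _  = contradiction h (∉⊥ u)
    rank-injective {u} {w} p q refl | suc k | _ | h | h′ =
      new-unique k h (new u eq) h′ (new w eq′)
      where
      new : ∀ x → rank x ≡ suc k → lookup (P k) x ≡ false
      new x e = ¬-not λ r → <-irrefl refl (≤-trans (≤-reflexive (≡-sym e)) (rank-≤ x r))

    record Parent (u w : Fin n) : Set where
      field
        j  : ℕ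
        w∈ : lookup (P (suc j)) w ≡ true
        w∉ : lookup (P j) w ≡ false
        u∈ : lookup (B (P (suc j))) u ≡ true
        u∉ : lookup (B (P j)) u ≡ false

    parent⁻ : ∀ u w → parent u w ≡ true → Parent u w
    parent⁻ u w p with lookup (P n) u in uP
    ... | true with lev u in eq
    -- At level 0 the truncated predecessor is again 0, so the two sets compared are equal and
    -- nothing is a parent: vertices of `B ⊥` are roots.
    ...   | zero  = contradiction p λ q → absurd (lookup ⊥ w) q
      where
      absurd : ∀ b → ¬ b ∧ not b ≡ true
      absurd true ()
      absurd false ()
    ...   | suc j = record
      { j  = j
      ; w∈ = ∧-conicalˡ _ _ p
      ; w∉ = negative (∧-conicalʳ (lookup (P (suc j)) w) _ p)
      ; u∈ = subst (λ k → lookup (B (P k)) u ≡ true) eq (lev-holds u uP)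
      ; u∉ = ¬-not λ q → <-irrefl refl (≤-trans (≤-reflexive (≡-sym eq)) (lev-≤ u q))
      }
      where
      negative : ∀ {b} → not b ≡ true → b ≡ false
      negative {false} _ = refl

    parent⁺ : ∀ u w → Parent u w → parent u w ≡ true
    parent⁺ u w record { j = j ; w∈ = w∈ ; w∉ = w∉ ; u∈ = u∈ ; u∉ = u∉ }
      rewrite lev≡suc u {j} u∈ u∉ | BP⊑Pn (suc j) u u∈ | w∈ | w∉ = refl

    lev-parent : ∀ {u w} (p : Parent u w) → lev u ≡ suc (Parent.j p)
    lev-parent {u} p = lev≡suc u {Parent.j p} (Parent.u∈ p) (Parent.u∉ p)

    parent-unique : ∀ {u w w′} → Parent u w → Parent u w′ → w ≡ w′
    parent-unique p q = new-unique (Parent.j p) (Parent.w∈ p) (Parent.w∉ p)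
      (subst (λ k → lookup (P (suc k)) _ ≡ true) (≡-sym same) (Parent.w∈ q))
      (subst (λ k → lookup (P k) _ ≡ false) (≡-sym same) (Parent.w∉ q))
      where
      same : Parent.j p ≡ Parent.j q
      same = suc-injective (trans (≡-sym (lev-parent p)) (lev-parent q))

    -- `w` is explored by step `j + 1`, but `u` is not yet eligible at step `j`, so it can enter
    -- only at a later step.
    rank-parent : ∀ {u w} → Parent u w → rank w < rank u
    rank-parent {u} {w} p = ≤-trans (s≤s (rank-≤ w {suc j} w∈))
      (≰⇒> λ le → u∉P (P-mono {rank u} {suc j} le u (rank-holds u (BP⊑Pn (suc j) u u∈))))
      where
      open Parent p
      u∉P : ¬ lookup (P (suc j)) u ≡ true
      u∉P r with P-suc⁻ j u r
      ... | inj₁ s = true≢false (P⊑B j u s) u∉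
      ... | inj₂ s = true≢false s u∉

    -- Where eligibility of `u` flips, the explored set must have changed, so that step is not stuck
    -- and the vertex it adds is the parent.
    find-parent : ∀ {k u} → lookup (B (P k)) u ≡ true →
                  lookup (B (P 0)) u ≡ true ⊎ ∃ λ w → lookup (P k) w ≡ true × Parent u w
    find-parent {k} {u} p with switch k p
    ... | inj₁ q = inj₁ q
    ... | inj₂ (j , j<k , q , r) with P (suc j) in eq | growth j
    ...   | _ | stuck _   = contradiction q (true≢false (subst (λ Q → lookup (B Q) u ≡ true) eq r))
    ...   | _ | add x a b = inj₂ (x , P-mono {suc j} {k} j<k x x∈ , record { j = j ; w∈ = x∈ ; w∉ = b ; u∈ = r ; u∉ = q })
      where
      x∈ : lookup (P (suc j)) x ≡ true
      x∈ = subst (λ Q → lookup Q x ≡ true) (≡-sym eq) (x∈insert x (P j))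

module Agreement {n : ℕ} (B B′ : Subset n → Subset n)
                 (agree : ∀ k → B′ (Process.P B k) ≡ B (Process.P B k)) where
  private
    module X = Process B
    module Y = Process B′

  -- The hypothesis concerns only the sets visited by the first process; by induction these are also
  -- the sets the second one visits.
  P-agree : ∀ k → Y.P k ≡ X.P k
  P-agree zero    = refl
  P-agree (suc k) = cong₂ grow (trans (cong B′ (P-agree k)) (agree k)) (P-agree k)

  lev-agree : ∀ u → Y.lev u ≡ X.lev u
  lev-agree u =
    first-cong (λ k → cong (λ Q → lookup Q u) (trans (cong B′ (P-agree k)) (agree k))) n

  parent-agree : ∀ u w → Y.parent u w ≡ X.parent u w
  parent-agree u w rewrite lev-agree u | P-agree n | P-agree (X.lev u) | P-agree (X.lev u ∸ 1) = refl

  tree-agree : Y.tree ≡ X.tree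
  tree-agree = tabulate-cong λ u → tabulate-cong λ w → cong₂ _∨_ (parent-agree u w) (parent-agree w u)

-- Exploration along the edges of a graph

Edge : ∀ {n} → Vec (Vec Bool n) n → Fin n → Fin n → Set
Edge F u w = lookup (lookup F u) w ≡ true

Touches : ∀ {n} → Vec (Vec Bool n) n → Fin n → Subset n → Fin n → Set
Touches F v P u = u ≡ v ⊎ ∃ λ w → lookup P w ≡ true × Edge F u w

touches? : ∀ {n} (F : Vec (Vec Bool n) n) v P u → Dec (Touches F v P u)
touches? F v P u =
  (u ≟ v) ⊎-dec any? λ w → (lookup P w ≟ᵇ true) ×-dec (lookup (lookup F u) w ≟ᵇ true)

spread : ∀ {n} → Vec (Vec Bool n) n → Fin n → Subset n → Subset n
spread F v P = tabulate λ u → does (touches? F v P u)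

module _ {n : ℕ} (F : Vec (Vec Bool n) n) (v : Fin n) where

  spread⁺ : ∀ {P u} → Touches F v P u → lookup (spread F v P) u ≡ true
  spread⁺ {P} {u} t = trans (lookup∘tabulate _ u) (dec-true (touches? F v P u) t)

  spread⁻ : ∀ P u → lookup (spread F v P) u ≡ true → Touches F v P u
  spread⁻ P u p = does-true (touches? F v P u) (trans (≡-sym (lookup∘tabulate _ u)) p)

  spread-mono : Monotone (spread F v)
  spread-mono P Q s u p with spread⁻ P u p
  ... | inj₁ e           = spread⁺ {Q} (inj₁ e)
  ... | inj₂ (w , q , r) = spread⁺ {Q} (inj₂ (w , s w q , r))

module _ {n : ℕ} (B : Subset n → Subset n) (mono : Monotone B) {v : Fin n}
         (root : lookup (B ⊥) v ≡ true) (only-root : ∀ u → lookup (B ⊥) u ≡ true → u ≡ v) where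
  open Process B
  open Mono mono

  tree-edge : ∀ {u w} → Edge tree u w → Parent u w ⊎ Parent w u
  tree-edge {u} {w} e with ∨-true (parent u w) (trans (≡-sym (lookup-tree u w)) e)
  ... | inj₁ p = inj₁ (parent⁻ u w p)
  ... | inj₂ p = inj₂ (parent⁻ w u p)

  parent-edge : ∀ {u w} → Parent u w → Edge tree u w
  parent-edge {u} {w} p = trans (lookup-tree u w) (cong (_∨ parent w u) (parent⁺ u w p))

  -- Consider a tree edge from `u` to a visited `w`. If `w` is the parent, its entry already made
  -- `u` eligible; if `u` is the parent, `w` could not have become eligible before `u` entered, so
  -- `u` is visited too.
  spread-tree : ∀ k → spread tree v (P k) ≡ B (P k)
  spread-tree k = ⊑-antisym to from
    where
    to : spread tree v (P k) ⊑ B (P k)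
    to u p with spread⁻ tree v (P k) u p
    ... | inj₁ refl = B-mono {0} {k} z≤n u root
    ... | inj₂ (w , w∈ , e) with tree-edge {u} {w} e
    ...   | inj₁ q = B-mono {suc (Parent.j q)} {k} (<-not-∈ w∈ (Parent.w∉ q)) u (Parent.u∈ q)
    ...   | inj₂ q with suc (Parent.j q) ≤? k
    ...     | yes le = P⊑B k u (P-mono le u (Parent.w∈ q))
    ...     | no nle = contradiction (Parent.u∉ q)
                 (true≢false (P⊑B (Parent.j q) w (P-mono (≤-pred (≰⇒> nle)) w w∈)))
    from : B (P k) ⊑ spread tree v (P k)
    from u p with find-parent {k} p
    ... | inj₁ q            = spread⁺ tree v {P k} (inj₁ (only-root u q))
    ... | inj₂ (w , w∈ , q) = spread⁺ tree v {P k} (inj₂ (w , w∈ , parent-edge q))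

  tree-lower : ∀ {u w} → Edge tree u w → rank w < rank u → Parent u w
  tree-lower {u} {w} e lt with tree-edge {u} {w} e
  ... | inj₁ p = p
  ... | inj₂ p = contradiction lt (<-asym (rank-parent p))

  tree-distinct : ∀ {u w} → Edge tree u w → rank u ≢ rank w
  tree-distinct {u} {w} e eq with tree-edge {u} {w} e
  ... | inj₁ p = <-irrefl (≡-sym eq) (rank-parent p)
  ... | inj₂ p = <-irrefl eq (rank-parent p)

  tree-symmetric : ∀ u w → lookup (lookup tree u) w ≡ lookup (lookup tree w) u
  tree-symmetric u w = trans (lookup-tree u w)
    (trans (∨-comm (parent u w) (parent w u)) (≡-sym (lookup-tree w u)))

  tree-⊑ : ∀ {u w} → Edge tree u w → lookup (P n) u ≡ true
  tree-⊑ {u} {w} e with tree-edge {u} {w} e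
  ... | inj₁ p = BP⊑Pn (suc (Parent.j p)) u (Parent.u∈ p)
  ... | inj₂ p = P⊑Pn (suc (Parent.j p)) u (Parent.w∈ p)

-- Along a cycle without backtracking the rank descends and then ascends,
-- so at the top both neighbours are lower.
module Acyclic {n : ℕ} (G : Graph n) (F : Vec (Vec Bool n) n) (rank : Fin n → ℕ)
  (symmetric : ∀ {u w} → Edge F u w → Edge F w u)
  (distinct : ∀ {u w} → Edge F u w → rank u ≢ rank w)
  (lower-unique : ∀ {u w w′} → Edge F u w → Edge F u w′ → rank w < rank u → rank w′ < rank u → w ≡ w′)
  where

  NonBacktracking : List (Fin n) → Set
  NonBacktracking (x ∷ y ∷ z ∷ zs) = x ≢ z × NonBacktracking (y ∷ z ∷ zs)
  NonBacktracking _ = Unit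

  unique-nonBacktracking : ∀ ys {t} → Unique ys → All (_≢ t) ys → NonBacktracking (ys ++ [ t ])
  unique-nonBacktracking []           _ _ = tt
  unique-nonBacktracking (_ ∷ [])     _ _ = tt
  unique-nonBacktracking (a ∷ b ∷ []) _ (a≢t ∷ _) = a≢t , tt
  unique-nonBacktracking (a ∷ b ∷ c ∷ ys) ((_ ∷ a≢c ∷ _) ∷ u) (_ ∷ q) =
    a≢c , unique-nonBacktracking (b ∷ c ∷ ys) u q

  up-or-down : ∀ {a b} → Edge F a b → rank a < rank b ⊎ rank b < rank a
  up-or-down {a} {b} e with rank a <? rank b
  ... | yes p = inj₁ p
  ... | no ¬p = inj₂ (≤∧≢⇒< (≮⇒≥ ¬p) (distinct e ∘ ≡-sym))

  -- After a rise, the only lower neighbour of the current vertex is the one just left, so a descent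
  -- would mean turning back.
  up : ∀ {y a} ys {t} → NonBacktracking (y ∷ a ∷ ys ++ [ t ]) → Linked G F (a ∷ ys ++ [ t ]) →
       Edge F y a → rank y < rank a → rank y < rank t
  up [] (y≢t , _) (at , _) ya y<a with up-or-down at
  ... | inj₁ a<t = <-trans y<a a<t
  ... | inj₂ t<a = contradiction (lower-unique (symmetric ya) at y<a t<a) y≢t
  up (b ∷ ys) (y≢b , nb) (ab , l) ya y<a with up-or-down ab
  ... | inj₁ a<b = <-trans y<a (up ys nb l ab a<b)
  ... | inj₂ b<a = contradiction (lower-unique (symmetric ya) ab y<a b<a) y≢b

  -- The induction runs from the far end of the walk. In the first alternative the walk falls all
  -- the way to `t`, and the extra clause records that the lower neighbour of `a` is its successor,
  -- which excludes a rise into `a` from in front. In the second, the walk enters `t` by a rise.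
  valley : ∀ {a} ys {t} → NonBacktracking (a ∷ ys ++ [ t ]) → Linked G F (a ∷ ys ++ [ t ]) →
    (rank t < rank a ×
      (∀ {y} → Edge F a y → NonBacktracking (y ∷ a ∷ ys ++ [ t ]) → ¬ rank y < rank a))
    ⊎ ∃ λ p → p ∈ a ∷ ys × Edge F p t × rank p < rank t
  valley {a} [] _ (at , _) with up-or-down at
  ... | inj₁ a<t = inj₂ (a , here refl , at , a<t)
  ... | inj₂ t<a = inj₁ (t<a , λ { ay (y≢t , _) y<a → y≢t (lower-unique ay at y<a t<a) })
  valley {a} (b ∷ ys) nb (ab , l) with valley ys (tail-nb ys nb) l
    where
    tail-nb : ∀ ys {t} → NonBacktracking (a ∷ b ∷ ys ++ [ t ]) → NonBacktracking (b ∷ ys ++ [ t ])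
    tail-nb []      (_ , nb) = nb
    tail-nb (_ ∷ _) (_ , nb) = nb
  ... | inj₂ (p , p∈ , q) = inj₂ (p , there p∈ , q)
  ... | inj₁ (t<b , q) with up-or-down ab
  ...   | inj₁ a<b = contradiction a<b (q (symmetric ab) nb)
  ...   | inj₂ b<a = inj₁ (<-trans t<b b<a , λ { ay (y≢b , _) y<a → y≢b (lower-unique ay ab y<a b<a) })

  acyclic : ¬ HasCycle G F
  acyclic (x , []         , () , _)
  acyclic (x , _ ∷ []     , s≤s () , _)
  acyclic (x , y ∷ z ∷ zs , _ , ((x≢y ∷ x≢z ∷ x≢zs) ∷ u) , (xy , yz , l))
    with unique-nonBacktracking (y ∷ z ∷ zs) u (All.map (_∘ ≡-sym) (x≢y ∷ x≢z ∷ x≢zs))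
  ... | nb with up-or-down xy
  ...   | inj₁ x<y = <-irrefl refl (up (z ∷ zs) (x≢z , nb) (yz , l) xy x<y)
  ...   | inj₂ y<x with valley zs (tail-nb zs nb) l
    where
    tail-nb : ∀ zs → NonBacktracking (y ∷ z ∷ zs ++ [ x ]) → NonBacktracking (z ∷ zs ++ [ x ])
    tail-nb []      (_ , nb) = nb
    tail-nb (_ ∷ _) (_ , nb) = nb
  -- A descent from `z` to `x` would put `y` below `z`, although the lower neighbour of `z` is its
  -- successor on the cycle.
  ...     | inj₁ (x<z , q) = q (symmetric yz) nb (<-trans y<x x<z)
  ...     | inj₂ (p , p∈ , px , p<x) with u
  ...       | y∉ ∷ _ = All.lookup y∉ p∈ (lower-unique xy (symmetric px) y<x p<x)

-- Subtrees

data Path {n : ℕ} (F : Vec (Vec Bool n) n) : Fin n → Fin n → List (Fin n) → Set where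
  end  : ∀ {w} → Path F w w [ w ]
  cons : ∀ {a z w zs} → Edge F a z → a ∉ zs → Path F z w zs → Path F a w (a ∷ zs)

module _ {n : ℕ} {F : Vec (Vec Bool n) n} where

  path-unique : ∀ {a w zs} → Path F a w zs → Unique zs
  path-unique end           = [] ∷ []
  path-unique (cons _ a∉ p) = ¬Any⇒All¬ _ a∉ ∷ path-unique p

  path-from : ∀ {Q : Fin n → Set} {a z w zs} → a ∈ zs → Path F z w zs → All Q zs →
              ∃ λ zs′ → Path F a w zs′ × All Q zs′
  path-from (here refl) end           q       = _ , end , q
  path-from (here refl) (cons e ∉ p)  q       = _ , cons e ∉ p , q
  path-from (there a∈)  (cons e ∉ p)  (_ ∷ q) = path-from a∈ p q

  path-linked : ∀ (G : Graph n) {y a w t zs} → Edge F y a → Path F a w zs → Edge F w t →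
                Linked G F (y ∷ zs ++ [ t ])
  path-linked G ya end          wt = ya , wt , tt
  path-linked G ya (cons e _ p) wt = ya , path-linked G e p wt

  Within : Subset n → Fin n → Fin n → Set
  Within Q a b = Edge F a b × lookup Q a ≡ true × lookup Q b ≡ true

  -- Loop erasure: if `a` already lies on the path found so far, the path is cut so as to start
  -- there.
  walk⇒path : ∀ Q {a b} → lookup Q b ≡ true → Star (Within Q) a b →
              ∃ λ zs → Path F a b zs × All (λ z → lookup Q z ≡ true) zs
  walk⇒path Q b∈ ε = _ , end , b∈ ∷ []
  walk⇒path Q {a} b∈ ((e , a∈ , _) ◅ s) with walk⇒path Q b∈ s
  ... | zs , p , q with _∈?_ _≟_ a zs
  ...   | yes m = path-from {λ z → lookup Q z ≡ true} m p q
  ...   | no a∉ = _ , cons e a∉ p , a∈ ∷ q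

  -- `z ≢ w` excludes the one-vertex path, which would only go along an edge and back. The two
  -- remaining cases differ only in exposing the two vertices that `HasCycle` asks for.
  path-cycle : ∀ (G : Graph n) {u z w zs} → z ≢ w → Edge F u z → Edge F w u →
               Path F z w zs → u ∉ zs → HasCycle G F
  path-cycle G z≢w _ _ end _ = contradiction refl z≢w
  path-cycle G _ uz wu p@(cons _ _ end) u∉ =
    _ , _ , s≤s (s≤s z≤n) , (¬Any⇒All¬ _ u∉ ∷ path-unique p) , path-linked G uz p wu
  path-cycle G _ uz wu p@(cons _ _ (cons _ _ _)) u∉ =
    _ , _ , s≤s (s≤s z≤n) , (¬Any⇒All¬ _ u∉ ∷ path-unique p) , path-linked G uz p wu

module Subtree {n : ℕ} (G : Graph n) {ℓ : ℕ} {v : Fin n} {S : Subset n} {F : Vec (Vec Bool n) n}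
               (T : IsSubtreeAt G ℓ v (S , F)) where

  open Process (spread F v) public
  open Mono (spread-mono F v) public

  private
    support   = proj₁ T
    symmetric = proj₁ (proj₂ T)
    connected = proj₁ (proj₂ (proj₂ T))
    no-cycle  = proj₁ (proj₂ (proj₂ (proj₂ T)))
    v∈S       = proj₂ (proj₂ (proj₂ (proj₂ (proj₂ T))))

  edge-adj : ∀ {u w} → Edge F u w → adj G u w ≡ true
  edge-adj {u} {w} e = proj₁ (support u w e)

  edge-sym : ∀ {u w} → Edge F u w → Edge F w u
  edge-sym {u} {w} e = trans (≡-sym (symmetric u w)) e

  edge-irrefl : ∀ {u} → ¬ Edge F u u
  edge-irrefl {u} e = true≢false (edge-adj e) (irrefl G u)

  spread-S : spread F v S ⊑ S
  spread-S u p with spread⁻ F v S u p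
  ... | inj₁ refl        = v∈S
  ... | inj₂ (w , _ , e) = proj₁ (proj₂ (support u w e))

  P⊑S : ∀ k → P k ⊑ S
  P⊑S = P-least S (spread-mono F v) spread-S

  v∈P : ∀ k → lookup (spread F v (P k)) v ≡ true
  v∈P k = spread⁺ F v {P k} (inj₁ refl)

  reach-P : ∀ {u} → Reach G F u v → lookup (P n) u ≡ true
  reach-P here                  = BP⊑Pn 0 v (v∈P 0)
  reach-P (there {u} {x} e r) = BP⊑Pn n u (spread⁺ F v {P n} (inj₂ (x , reach-P r , e)))

  Pn≡S : P n ≡ S
  Pn≡S = ⊑-antisym (P⊑S n) λ u u∈ → reach-P (connected u v u∈ v∈S)

  spread-⊥ : ∀ u → lookup (spread F v ⊥) u ≡ true → u ≡ v
  spread-⊥ u p with spread⁻ F v ⊥ u p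
  ... | inj₁ e           = e
  ... | inj₂ (w , w∈ , _) = contradiction w∈ (∉⊥ w)

  rank-v : rank v ≤ 1
  rank-v = rank-≤ v {1} v∈P₁
    where
    v∈P₁ : lookup (P 1) v ≡ true
    v∈P₁ with P 1 | growth 0
    ... | _ | stuck s   = contradiction (s v (v∈P 0)) (∉⊥ v)
    ... | _ | add x q _ with spread-⊥ x q
    ...   | refl = x∈insert v ⊥

  within-sym : ∀ Q {a b} → Within {F = F} Q a b → Within {F = F} Q b a
  within-sym Q (e , a∈ , b∈) = edge-sym e , b∈ , a∈

  -- Each explored vertex other than `v` was touched from an earlier one. `Q` stays fixed while `k`
  -- drops, so all steps live in the same relation.
  walk-to-root : ∀ Q k → P k ⊑ Q → ∀ {a} → lookup (P k) a ≡ true → Star (Within {F = F} Q) a v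
  walk-to-root Q zero    _ {a} p = contradiction p (∉⊥ a)
  walk-to-root Q (suc k) s {a} p with P-suc⁻ k a p
  ... | inj₁ q = walk-to-root Q k (λ u → s u ∘ P-step k u) q
  ... | inj₂ q with spread⁻ F v (P k) a q
  ...   | inj₁ refl         = ε
  ...   | inj₂ (z , z∈ , e) =
    (e , s a p , s z (P-step k z z∈)) ◅ walk-to-root Q k (λ u → s u ∘ P-step k u) z∈

  -- If u touched the explored set before w entered it, the explored set would
  -- contain a path between two neighbours of u.
  edge-parent : ∀ {u w} → Edge F u w → lookup (P n) u ≡ true → lookup (P n) w ≡ true →
                rank w < rank u → Parent u w
  edge-parent {u} {w} e u∈ w∈ lt = go (rank w) refl (rank-holds w w∈)
    where
    go : ∀ k → rank w ≡ k → lookup (P k) w ≡ true → Parent u w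
    go zero    _  p = contradiction p (∉⊥ w)
    go (suc j) eq p = record
      { j  = j
      ; w∈ = p
      ; w∉ = w∉
      ; u∈ = spread⁺ F v {P (suc j)} (inj₂ (w , p , e))
      ; u∉ = ¬-not untouched
      }
      where
      w∉ : lookup (P j) w ≡ false
      w∉ = ¬-not λ q → <-irrefl refl (≤-trans (≤-reflexive (≡-sym eq)) (rank-≤ w {j} q))
      u∉P : ¬ lookup (P (suc j)) u ≡ true
      u∉P q = <-irrefl refl (≤-trans lt (≤-trans (rank-≤ u {suc j} q) (≤-reflexive (≡-sym eq))))
      untouched : ¬ lookup (spread F v (P j)) u ≡ true
      untouched q with spread⁻ F v (P j) u q
      -- The root is explored at the first step, so no `w` has a smaller rank.
      ... | inj₁ refl = <-irrefl refl (≤-trans (s≤s (rank-positive w w∈)) (≤-trans lt rank-v))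
      ... | inj₂ (z , z∈ , uz)
        with walk⇒path (P (suc j)) p
               (walk-to-root (P (suc j)) (suc j) (λ _ → id) (P-step j z z∈) ◅◅
                reverse (within-sym (P (suc j)))
                        (walk-to-root (P (suc j)) (suc j) (λ _ → id) p))
      ...   | zs , path , inside = no-cycle
        (path-cycle G (λ { refl → true≢false z∈ w∉ }) uz (edge-sym e) path
                    (λ u∈zs → u∉P (All.lookup inside u∈zs)))

  -- Ranks on the tree are distinct, so each edge of `F` joins its higher end to that end's parent.
  -- Conversely, the edge of `F` through which `u` became touched must lead to the single vertex
  -- that entered at that step.
  tree≡F : tree ≡ F
  tree≡F = lookup-ext λ u → lookup-ext λ w → trans (lookup-tree u w) (bool-ext (to u w) (from u w))
    where
    parent-F : ∀ {u w} → Parent u w → Edge F u w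
    parent-F {u} {w} record { j = j ; w∈ = w∈ ; w∉ = w∉ ; u∈ = u∈ ; u∉ = u∉ }
      with spread⁻ F v (P (suc j)) u u∈
    ... | inj₁ refl = contradiction u∉ (true≢false (v∈P j))
    ... | inj₂ (z , z∈ , e) with new-unique j w∈ w∉ z∈ (¬-not λ q →
                  true≢false (spread⁺ F v {P j} (inj₂ (z , q , e))) u∉)
    ...   | refl = e
    to : ∀ u w → parent u w ∨ parent w u ≡ true → Edge F u w
    to u w p with ∨-true (parent u w) p
    ... | inj₁ q = parent-F (parent⁻ u w q)
    ... | inj₂ q = edge-sym (parent-F (parent⁻ w u q))
    from : ∀ u w → Edge F u w → parent u w ∨ parent w u ≡ true
    from u w e with support u w e
    ... | _ , u∈S , w∈S with subst (λ Q → lookup Q u ≡ true) (≡-sym Pn≡S) u∈S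
                           | subst (λ Q → lookup Q w ≡ true) (≡-sym Pn≡S) w∈S
    ...   | u∈ | w∈ with rank w <? rank u
    ...     | yes lt = cong (_∨ parent w u) (parent⁺ u w (edge-parent e u∈ w∈ lt))
    ...     | no nlt = trans (cong (parent u w ∨_) (parent⁺ w u (edge-parent (edge-sym e) w∈ u∈
                         (≤∧≢⇒< (≮⇒≥ nlt) λ eq → edge-irrefl (subst (Edge F u)
                           (≡-sym (rank-injective u∈ w∈ eq)) e)))))
                         (∨-zeroʳ (parent u w))

-- Degrees

module Degree {n : ℕ} (G : Graph n) where

  deg-mono : ∀ {P Q} u → P ⊑ Q → deg G P u ≤ deg G Q u
  deg-mono {P} {Q} u s = sum-map-mono (allFin n) λ w → pointwise w
    where
    pointwise : ∀ w → (if lookup P w ∧ adj G u w then 1 else 0) ≤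
                      (if lookup Q w ∧ adj G u w then 1 else 0)
    pointwise w with lookup P w in eq
    ... | false = z≤n
    ... | true rewrite s w eq = ≤-refl

  deg-split : ∀ S u → deg G ⊤ u ≡ deg G S u + deg G (∁ S) u
  deg-split S u = sum-map-+ (allFin n) pointwise
    where
    pointwise : ∀ w → (if lookup ⊤ w ∧ adj G u w then 1 else 0) ≡
      (if lookup S w ∧ adj G u w then 1 else 0) + (if lookup (∁ S) w ∧ adj G u w then 1 else 0)
    pointwise w rewrite ∈⊤ w | lookup-∁ S w with lookup S w
    ... | true  = ≡-sym (+-identityʳ _)
    ... | false = refl

  deg-≤⊤ : ∀ P u → deg G P u ≤ deg G ⊤ u
  deg-≤⊤ P u = deg-mono {P} {⊤} u λ w _ → ∈⊤ w

  deg-disjoint : ∀ {P Q} u → (∀ w → lookup Q w ≡ true → lookup P w ≡ false) →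
                 deg G P u + deg G Q u ≤ deg G ⊤ u
  deg-disjoint {P} {Q} u disj = ≤-trans
    (+-monoʳ-≤ (deg G P u) (deg-mono {Q} {∁ P} u
      λ w q → trans (lookup-∁ P w) (cong not (disj w q))))
    (≤-reflexive (≡-sym (deg-split P u)))

  deg-empty : ∀ {P} u → (∀ w → lookup P w ≡ false) → deg G P u ≡ 0
  deg-empty {P} u empty = go (allFin n)
    where
    go : ∀ xs → sum (map (λ w → if lookup P w ∧ adj G u w then 1 else 0) xs) ≡ 0
    go []       = refl
    go (x ∷ xs) rewrite empty x = go xs

  deg-⊥ : ∀ u → deg G ⊥ u ≡ 0
  deg-⊥ u = deg-empty {⊥} u λ w → lookup-replicate w false

  deg-≤-length : ∀ P u → deg G P u ≤ length (allFin n)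
  deg-≤-length P u = go (allFin n)
    where
    go : ∀ xs → sum (map (λ w → if lookup P w ∧ adj G u w then 1 else 0) xs) ≤ length xs
    go []       = z≤n
    go (x ∷ xs) with lookup P x ∧ adj G u x
    ... | true  = s≤s (go xs)
    ... | false = m≤n⇒m≤1+n (go xs)

  deg-insert : ∀ {P x} u → lookup P x ≡ false →
               deg G (insert x P) u ≡ deg G P u + (if adj G u x then 1 else 0)
  deg-insert {P} {x} u x∉ = sum-allFin-bump x _ at off
    where
    at : (if lookup (insert x P) x ∧ adj G u x then 1 else 0) ≡
         (if lookup P x ∧ adj G u x then 1 else 0) + (if adj G u x then 1 else 0)
    at rewrite x∈insert x P | x∉ = refl
    off : ∀ w → w ≢ x → (if lookup (insert x P) w ∧ adj G u w then 1 else 0) ≡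
                        (if lookup P w ∧ adj G u w then 1 else 0)
    off w w≢x rewrite lookup∘update′ w≢x P true = refl

  deg-insert-≤ : ∀ {P x} u → lookup P x ≡ false → deg G (insert x P) u ≤ suc (deg G P u)
  deg-insert-≤ {P} {x} u x∉ rewrite deg-insert {P} u x∉ with adj G u x
  ... | true  = ≤-reflexive (+-comm _ 1)
  ... | false = ≤-trans (≤-reflexive (+-identityʳ _)) (n≤1+n _)

  deg-insert-self : ∀ {P} u → lookup P u ≡ false → deg G (insert u P) u ≡ deg G P u
  deg-insert-self {P} u u∉ = trans (deg-insert {P} u u∉)
    (trans (cong (λ b → deg G P u + (if b then 1 else 0)) (irrefl G u)) (+-identityʳ _))

  deg-insert-adj : ∀ {P x} u → lookup P x ≡ false → adj G u x ≡ true →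
                   deg G (insert x P) u ≡ suc (deg G P u)
  deg-insert-adj {P} u x∉ a = trans (deg-insert {P} u x∉)
    (trans (cong (λ b → deg G P u + (if b then 1 else 0)) a) (+-comm _ 1))

  deg-insert-nonadj : ∀ {P x} u → lookup P x ≡ false → adj G u x ≡ false →
                      deg G (insert x P) u ≡ deg G P u
  deg-insert-nonadj {P} u x∉ a = trans (deg-insert {P} u x∉)
    (trans (cong (λ b → deg G P u + (if b then 1 else 0)) a) (+-identityʳ _))

  deg-< : ∀ {P Q x} u → P ⊑ Q → lookup Q x ≡ true → lookup P x ≡ false → adj G u x ≡ true →
          deg G P u < deg G Q u
  deg-< {P} {Q} {x} u s x∈ x∉ a =
    subst (_≤ deg G Q u) (deg-insert-adj {P} u x∉ a) (deg-mono {insert x P} {Q} u (insert-⊑ {P = P} {Q} s x∈))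

-- Legal configurations

  -- Absence of forbidden subconfigurations, as in the sandpile model. Unlike a sequence of
  -- reverse-firings, this form restricts at once to subsets of `W`.
  NoForbidden : Subset n → Vec ℕ n → Set
  NoForbidden W C = ∀ A → A ⊑ W → (∃ λ x → lookup A x ≡ true) →
                    ∃ λ u → lookup A u ≡ true × deg G A u ≤ lookup C u

  lookup-reverseFire : ∀ W v C u → lookup (reverseFire G W v C) u ≡
    (if does (u ≟ v) then lookup C v + suc (deg G W v)
     else (if nbr G W v u then lookup C u ∸ 1 else lookup C u))
  lookup-reverseFire W v C u = lookup∘tabulate _ u

  remove-∉ : ∀ (v : Fin n) (A : Subset n) → lookup (remove v A) v ≡ false
  remove-∉ v A = lookup∘update v A false

  remove-self : ∀ {v A u} → lookup (remove v A) u ≡ true → u ≢ v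
  remove-self {v} {A} p refl = true≢false p (remove-∉ v A)

  deg-remove : ∀ {A v} → lookup A v ≡ true → ∀ u →
               deg G A u ≡ deg G (remove v A) u + (if adj G u v then 1 else 0)
  deg-remove {A} {v} v∈ u = trans (cong (λ Q → deg G Q u) (≡-sym (insert-remove v A v∈)))
    (deg-insert {remove v A} u (remove-∉ v A))

  -- The vertex of A that is last to be reverse-fired has by then given a chip to
  -- each of its neighbours in A.
  reaches⇒noForbidden : ∀ {W C} → ReachesSupercritical G W C → NoForbidden W C
  reaches⇒noForbidden {W} (done s) A A⊑W (x , x∈) =
    x , x∈ , ≤-trans (deg-mono {A} {W} x A⊑W) (<⇒≤ (s x (A⊑W x x∈)))
  reaches⇒noForbidden {W} {C} (step v (v∈W , pos) r) A A⊑W (x , x∈)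
    with reaches⇒noForbidden r | lookup A v in v∈?
  ... | ih | false with ih A A⊑W (x , x∈)
  ...   | u , u∈ , le = u , u∈ , ≤-trans le
    (≤-trans (≤-reflexive (lookup-reverseFire W v C u)) below)
    where
    below : (if does (u ≟ v) then lookup C v + suc (deg G W v)
             else (if nbr G W v u then lookup C u ∸ 1 else lookup C u)) ≤ lookup C u
    below with u ≟ v
    ... | yes refl = contradiction v∈? (true≢false u∈)
    ... | no _ with nbr G W v u
    ...   | true  = m∸n≤m _ 1
    ...   | false = ≤-refl
  reaches⇒noForbidden {W} {C} (step v (v∈W , pos) r) A A⊑W (x , x∈) | ih | true
    with any? (λ y → lookup (remove v A) y ≟ᵇ true)
  ... | no none = v , v∈? , subst (_≤ lookup C v) (≡-sym deg0) z≤n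
    where
    deg0 : deg G A v ≡ 0
    deg0 = trans (deg-remove {A} v∈? v)
      (trans (cong (λ b → deg G (remove v A) v + (if b then 1 else 0)) (irrefl G v))
        (trans (+-identityʳ _)
          (deg-empty {remove v A} v λ y → ¬-not λ q → none (y , q))))
  ... | yes some with ih (remove v A) (λ u → A⊑W u ∘ remove-⊑ v A u) some
  ...   | u , u∈ , le = u , remove-⊑ v A u u∈ , subst (_≤ lookup C u) (≡-sym (deg-remove {A} v∈? u)) bound
    where
    bound : deg G (remove v A) u + (if adj G u v then 1 else 0) ≤ lookup C u
    bound with ≤-trans le (≤-reflexive (lookup-reverseFire W v C u)) | pos u
    ... | le′ | pos′ rewrite dec-false (u ≟ v) (remove-self {v} {A} u∈)
                           | A⊑W u (remove-⊑ v A u u∈) | Graph.sym G v u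
      with adj G u v
    ...   | true  = ≤-trans (+-monoˡ-≤ 1 le′) (≤-reflexive (m∸n+n≡m (pos′ refl)))
    ...   | false = ≤-trans (≤-reflexive (+-identityʳ _)) le′

  -- The net effect of reverse-firing each vertex of `A` once, independent of the order; the
  -- subtraction is exact when the chips suffice.
  reverseFireAll : Subset n → Subset n → Vec ℕ n → Vec ℕ n
  reverseFireAll W A C = tabulate λ u →
    if lookup W u then (lookup C u + (if lookup A u then suc (deg G W u) else 0)) ∸ deg G A u
    else lookup C u

  lookup-reverseFireAll : ∀ W A C u → lookup (reverseFireAll W A C) u ≡
    (if lookup W u then (lookup C u + (if lookup A u then suc (deg G W u) else 0)) ∸ deg G A u
     else lookup C u)
  lookup-reverseFireAll W A C u = lookup∘tabulate _ u

  reverseFireAll-empty : ∀ W {A} C → (∀ w → lookup A w ≡ false) → reverseFireAll W A C ≡ C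
  reverseFireAll-empty W {A} C empty = lookup-ext λ u → trans (lookup-reverseFireAll W A C u) (at u)
    where
    at : ∀ u → (if lookup W u then (lookup C u + (if lookup A u then suc (deg G W u) else 0)) ∸ deg G A u
                else lookup C u) ≡ lookup C u
    at u rewrite empty u | deg-empty {A} u empty | +-identityʳ (lookup C u) with lookup W u
    ... | true  = refl
    ... | false = refl

  reverseFireAll-insert : ∀ W {A v} C → lookup W v ≡ true → lookup A v ≡ false →
    deg G A v ≤ lookup C v →
    reverseFire G W v (reverseFireAll W A C) ≡ reverseFireAll W (insert v A) C
  reverseFireAll-insert W {A} {v} C v∈W v∉A le = lookup-ext λ u →
    trans (lookup-reverseFire W v (reverseFireAll W A C) u)
      (trans (at u) (≡-sym (lookup-reverseFireAll W (insert v A) C u)))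
    where
    at : ∀ u → (if does (u ≟ v) then lookup (reverseFireAll W A C) v + suc (deg G W v)
                else (if nbr G W v u then lookup (reverseFireAll W A C) u ∸ 1
                      else lookup (reverseFireAll W A C) u)) ≡
               (if lookup W u then
                  (lookup C u + (if lookup (insert v A) u then suc (deg G W u) else 0))
                    ∸ deg G (insert v A) u
                else lookup C u)
    at u with u ≟ v
    ... | yes refl rewrite lookup-reverseFireAll W A C u | v∈W | v∉A | x∈insert u A
                         | deg-insert-self {A} u v∉A | +-identityʳ (lookup C u) =
      ≡-sym (+-∸-comm (suc (deg G W u)) le)
    ... | no u≢v rewrite lookup-reverseFireAll W A C u | lookup∘update′ u≢v A true
                       | deg-insert {A} u v∉A | Graph.sym G v u
      with lookup W u
    ...   | false = refl
    ...   | true with adj G u v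
    ...     | true  = ∸-+-assoc _ (deg G A u) 1
    ...     | false = cong ((lookup C u + (if lookup A u then suc (deg G W u) else 0)) ∸_)
                             (≡-sym (+-identityʳ (deg G A u)))

  -- The order of reverse-firings is built from its end. The vertex `v` supplied by `NoForbidden`
  -- comes last within `A`, since its own chips pay for all its neighbours in `A`; the condition on
  -- vertices outside `A` says the same of those already placed later.
  reverseFireAll-reaches : ∀ {W C} → NoForbidden W C → ∀ k A → ∣ A ∣ ≡ k → A ⊑ W →
    (∀ u → lookup W u ≡ true → lookup A u ≡ false → deg G A u ≤ lookup C u) →
    ReachesSupercritical G W (reverseFireAll W A C) → ReachesSupercritical G W C
  reverseFireAll-reaches {W} {C} nf k A size A⊑W outer r
    with any? (λ y → lookup A y ≟ᵇ true)
  ... | no none = subst (ReachesSupercritical G W)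
                        (reverseFireAll-empty W {A} C λ y → ¬-not λ q → none (y , q)) r
  ... | yes some with nf A A⊑W some
  ...   | v , v∈ , le = go k size
    where
    A′ = remove v A
    A≡ : insert v A′ ≡ A
    A≡ = insert-remove v A v∈
    deg≤ : ∀ u → deg G A′ u ≤ deg G A u
    deg≤ u = deg-mono {A′} {A} u (remove-⊑ v A)
    outer′ : ∀ u → lookup W u ≡ true → lookup A′ u ≡ false → deg G A′ u ≤ lookup C u
    outer′ u u∈W u∉ with u ≟ v
    ... | yes refl = ≤-trans (deg≤ v) le
    ... | no u≢v   = ≤-trans (deg≤ u)
      (outer u u∈W (trans (≡-sym (lookup∘update′ u≢v A false)) u∉))
    -- A neighbour in `A′` has gained one chip more than its degree in `W` and paid at most that
    -- degree. A neighbour outside `A` has a chip left over, because `v` also counts in its degree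
    -- in `A`.
    positive : ∀ u → nbr G W v u ≡ true → 1 ≤ lookup (reverseFireAll W A′ C) u
    positive u nb with ∧-conicalˡ (lookup W u) _ nb | ∧-conicalʳ (lookup W u) _ nb
    ... | u∈W | a rewrite lookup-reverseFireAll W A′ C u | u∈W with lookup A′ u in u∈?
    ...   | true  = m<n⇒0<n∸m (≤-trans (s≤s (deg-mono {A′} {W} u λ w → A⊑W w ∘ remove-⊑ v A w))
                                       (m≤n+m _ (lookup C u)))
    ...   | false = m<n⇒0<n∸m (≤-trans
      (≤-reflexive (trans (≡-sym (deg-insert-adj {A′} u (remove-∉ v A) (trans (Graph.sym G u v) a)))
                          (cong (λ Q → deg G Q u) A≡)))
      (≤-trans (outer u u∈W (trans (≡-sym (lookup∘update′ u≢v A false)) u∈?))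
               (m≤m+n (lookup C u) 0)))
      where
      u≢v : u ≢ v
      u≢v refl = true≢false a (irrefl G v)
    fired : ReachesSupercritical G W (reverseFireAll W A′ C)
    fired = step v (A⊑W v v∈ , positive) (subst (ReachesSupercritical G W)
      (trans (cong (λ Q → reverseFireAll W Q C) (≡-sym A≡))
        (≡-sym (reverseFireAll-insert W {A′} C (A⊑W v v∈) (remove-∉ v A) (≤-trans (deg≤ v) le)))) r)
    go : ∀ k → ∣ A ∣ ≡ k → ReachesSupercritical G W C
    go zero    eq = contradiction
      (trans (≡-sym (∣insert∣ v A′ (remove-∉ v A))) (trans (cong ∣_∣ A≡) eq)) λ ()
    go (suc k) eq = reverseFireAll-reaches nf k A′
      (suc-injective (trans (≡-sym (∣insert∣ v A′ (remove-∉ v A))) (trans (cong ∣_∣ A≡) eq)))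
      (λ u → A⊑W u ∘ remove-⊑ v A u) outer′ fired

  lookup-reverseFireAll-full : ∀ W C u → lookup W u ≡ true →
                               lookup (reverseFireAll W W C) u ≡ suc (lookup C u)
  lookup-reverseFireAll-full W C u u∈W = trans (lookup-reverseFireAll W W C u) at
    where
    at : (if lookup W u then (lookup C u + (if lookup W u then suc (deg G W u) else 0)) ∸ deg G W u
          else lookup C u) ≡ suc (lookup C u)
    at rewrite u∈W | +-suc (lookup C u) (deg G W u) = m+n∸n≡m (suc (lookup C u)) (deg G W u)

  -- Reverse-firing all of `W` once gives every vertex of `W` exactly one more chip, which preserves
  -- `NoForbidden`; `m` such rounds make up the deficit.
  noForbidden⇒reaches : ∀ {W} m C → NoForbidden W C →
    (∀ u → lookup W u ≡ true → deg G W u < lookup C u + m) → ReachesSupercritical G W C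
  noForbidden⇒reaches {W} zero C nf bound =
    done λ u u∈W → subst (deg G W u <_) (+-identityʳ _) (bound u u∈W)
  noForbidden⇒reaches {W} (suc m) C nf bound =
    reverseFireAll-reaches nf ∣ W ∣ W refl (λ _ → id)
      (λ u u∈ u∉ → contradiction u∉ (true≢false u∈))
      (noForbidden⇒reaches m (reverseFireAll W W C) nf′ bound′)
    where
    plus1 = lookup-reverseFireAll-full W C
    nf′ : NoForbidden W (reverseFireAll W W C)
    nf′ A A⊑W some with nf A A⊑W some
    ... | u , u∈ , le = u , u∈ ,
      subst (deg G A u ≤_) (≡-sym (plus1 u (A⊑W u u∈))) (m≤n⇒m≤1+n le)
    bound′ : ∀ u → lookup W u ≡ true → deg G W u < lookup (reverseFireAll W W C) u + m
    bound′ u u∈W rewrite plus1 u u∈W = subst (deg G W u <_) (+-suc (lookup C u) m) (bound u u∈W)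

  noForbidden⇒legal : ∀ {W C} → OnW G W C → NoForbidden W C → Legal G W C
  -- One round more than the number of vertices exceeds every degree, so this many rounds suffice
  -- even without any chips.
  noForbidden⇒legal {W} {C} on nf = on , noForbidden⇒reaches (suc (length (allFin n))) C nf
    λ u _ → ≤-trans (s≤s (deg-≤-length W u)) (m≤n+m _ (lookup C u))

-- The burn-off game

-- The chips a vertex loses by its own firing are left out of the count. This keeps the operator
-- monotone and leaves fired vertices in its value.
burn : ∀ {n} → Graph n → Vec ℕ n → Subset n → Subset n
burn G X P = tabulate λ u → does (deg G ⊤ u <? lookup X u + deg G P u)

module _ {n : ℕ} (G : Graph n) (X : Vec ℕ n) where
  open Degree G

  burn⁺ : ∀ P u → deg G ⊤ u < lookup X u + deg G P u → lookup (burn G X P) u ≡ true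
  burn⁺ P u lt = trans (lookup∘tabulate _ u) (dec-true (_ <? _) lt)

  burn⁻ : ∀ P u → lookup (burn G X P) u ≡ true → deg G ⊤ u < lookup X u + deg G P u
  burn⁻ P u p = does-true (_ <? _) (trans (≡-sym (lookup∘tabulate _ u)) p)

  burn-mono : Monotone (burn G X)
  burn-mono P Q s u p =
    burn⁺ Q u (≤-trans (burn⁻ P u p) (+-monoʳ-≤ (lookup X u) (deg-mono {P} {Q} u s)))

fires-snoc : ∀ {n} {G : Graph n} {W C k D} v → Fires G W C k D → CanFire G W v D →
             Fires G W C (suc k) (fire G W v D)
fires-snoc v nil          cf = cons v cf nil
fires-snoc v (cons w c f) cf = cons w c (fires-snoc v f cf)

module Game {n : ℕ} (G : Graph n) (X : Vec ℕ n)
            (bounded : ∀ u → lookup X u ≤ suc (deg G ⊤ u)) where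
  open Degree G
  open Process (burn G X) public
  open Mono (burn-mono G X) public

  fired : Subset n → Vec ℕ n
  fired Q = tabulate λ u →
    (lookup X u + deg G Q u) ∸ (if lookup Q u then suc (deg G ⊤ u) else 0)

  lookup-fired : ∀ Q u → lookup (fired Q) u ≡
    (lookup X u + deg G Q u) ∸ (if lookup Q u then suc (deg G ⊤ u) else 0)
  lookup-fired Q u = lookup∘tabulate _ u

  fired-⊥ : fired ⊥ ≡ X
  fired-⊥ = lookup-ext λ u → trans (lookup-fired ⊥ u) (at u)
    where
    at : ∀ u → (lookup X u + deg G ⊥ u) ∸ (if lookup ⊥ u then suc (deg G ⊤ u) else 0) ≡ lookup X u
    at u rewrite lookup-replicate u false | deg-⊥ u = +-identityʳ _

  -- A vertex starts with at most one chip above its degree and receives at most its degree from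
  -- neighbours that fire once each; after paying for one firing it cannot fire again.
  fired-∈ : ∀ Q u → lookup Q u ≡ true → lookup (fired Q) u ≤ deg G ⊤ u
  fired-∈ Q u u∈ = ≤-trans (≤-reflexive (trans (lookup-fired Q u) at))
    (m≤n+o⇒m∸n≤o _ (suc (deg G ⊤ u)) (+-mono-≤ (bounded u) (deg-≤⊤ Q u)))
    where
    at : (lookup X u + deg G Q u) ∸ (if lookup Q u then suc (deg G ⊤ u) else 0) ≡
         (lookup X u + deg G Q u) ∸ suc (deg G ⊤ u)
    at rewrite u∈ = refl

  fired-∉ : ∀ Q u → lookup Q u ≡ false → lookup (fired Q) u ≡ lookup X u + deg G Q u
  fired-∉ Q u u∉ = trans (lookup-fired Q u)
    (cong (λ b → (lookup X u + deg G Q u) ∸ (if b then suc (deg G ⊤ u) else 0)) u∉)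

  canFire⁻ : ∀ Q u → CanFire G ⊤ u (fired Q) → lookup Q u ≡ false × lookup (burn G X Q) u ≡ true
  canFire⁻ Q u (_ , lt) = u∉ , burn⁺ G X Q u (subst (deg G ⊤ u <_) (fired-∉ Q u u∉) lt)
    where
    u∉ : lookup Q u ≡ false
    u∉ = ¬-not λ u∈ → <-irrefl refl (≤-trans lt (fired-∈ Q u u∈))

  canFire⁺ : ∀ Q u → lookup Q u ≡ false → lookup (burn G X Q) u ≡ true → CanFire G ⊤ u (fired Q)
  canFire⁺ Q u u∉ b = ∈⊤ u , subst (deg G ⊤ u <_) (≡-sym (fired-∉ Q u u∉)) (burn⁻ G X Q u b)

  -- The inclusion in `burn G X Q` says that every vertex of `Q` can afford its firing, so a chip
  -- arriving later commutes with the truncated subtraction.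
  fire-fired : ∀ Q x → Q ⊑ burn G X Q → lookup Q x ≡ false →
               fire G ⊤ x (fired Q) ≡ fired (insert x Q)
  fire-fired Q x Q⊑ x∉ = lookup-ext λ u →
    trans (lookup∘tabulate _ u) (trans (at u) (≡-sym (lookup-fired (insert x Q) u)))
    where
    at : ∀ u → (if does (u ≟ x) then lookup (fired Q) x ∸ suc (deg G ⊤ x)
                else (if nbr G ⊤ x u then suc (lookup (fired Q) u) else lookup (fired Q) u)) ≡
      (lookup X u + deg G (insert x Q) u) ∸ (if lookup (insert x Q) u then suc (deg G ⊤ u) else 0)
    at u with u ≟ x
    ... | yes refl rewrite x∈insert u Q | fired-∉ Q u x∉ | deg-insert-self {Q} u x∉ = refl
    ... | no u≢x rewrite lookup∘update′ u≢x Q true | ∈⊤ u | Graph.sym G x u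
                       | lookup-fired Q u with adj G u x in a
    ...   | false rewrite deg-insert-nonadj {Q} u x∉ a = refl
    ...   | true rewrite deg-insert-adj {Q} u x∉ a | +-suc (lookup X u) (deg G Q u)
      with lookup Q u in u∈?
    ...     | false = refl
    ...     | true  = ≡-sym (+-∸-assoc 1 (burn⁻ G X Q u (Q⊑ u u∈?)))

  relaxed⁺ : ∀ Q → burn G X Q ⊑ Q → Relaxed G ⊤ (fired Q)
  relaxed⁺ Q closed = (λ u p → contradiction p (true≢false (∈⊤ u))) , λ u _ → small u
    where
    small : ∀ u → lookup (fired Q) u ≤ deg G ⊤ u
    small u with lookup Q u in u∈?
    ... | true  = fired-∈ Q u u∈?
    ... | false = ≤-trans (≤-reflexive (fired-∉ Q u u∈?))
      (≮⇒≥ λ lt → true≢false (closed u (burn⁺ G X Q u lt)) u∈?)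

  relaxed⁻ : ∀ Q → Relaxed G ⊤ (fired Q) → burn G X Q ⊑ Q
  relaxed⁻ Q (_ , small) u b with lookup Q u in u∈?
  ... | true  = refl
  ... | false = contradiction
    (≤-trans (burn⁻ G X Q u b) (≤-trans (≤-reflexive (≡-sym (fired-∉ Q u u∈?))) (small u (∈⊤ u))))
    (<-irrefl refl)

  insert-⊑burn : ∀ Q x → Q ⊑ burn G X Q → lookup (burn G X Q) x ≡ true →
                 insert x Q ⊑ burn G X (insert x Q)
  insert-⊑burn Q x Q⊑ b = insert-⊑ {P = Q} {burn G X (insert x Q)} (λ u p → up u (Q⊑ u p)) (up x b)
    where
    up : burn G X Q ⊑ burn G X (insert x Q)
    up = burn-mono G X Q (insert x Q) (insert⁺ x Q)

  -- No vertex fires twice, so a play is described by its set of fired vertices.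
  fires-length : ∀ {k D} Q → Q ⊑ burn G X Q → Q ⊑ P n → Fires G ⊤ (fired Q) k D →
                 Relaxed G ⊤ D → ∣ P n ∣ ≡ ∣ Q ∣ + k
  fires-length Q Q⊑ Q⊑Pn nil rel = trans
    (cong ∣_∣ (⊑-antisym {P = P n} {Q} (P-least Q (burn-mono G X) (relaxed⁻ Q rel) n) Q⊑Pn)) (≡-sym (+-identityʳ _))
  fires-length {suc k} {D} Q Q⊑ Q⊑Pn (cons x cf fs) rel with canFire⁻ Q x cf
  ... | x∉ , b = trans
    (fires-length (insert x Q) (insert-⊑burn Q x Q⊑ b)
      (insert-⊑ {P = Q} {P n} Q⊑Pn (closed x (burn-mono G X Q (P n) Q⊑Pn x b)))
      (subst (λ Y → Fires G ⊤ Y k D) (fire-fired Q x Q⊑ x∉) fs) rel)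
    (trans (cong (_+ k) (∣insert∣ x Q x∉)) (≡-sym (+-suc ∣ Q ∣ k)))

  -- A stuck step fires nothing, hence the length is the size of `P k` and not `k`.
  fires-P : ∀ k → Fires G ⊤ X ∣ P k ∣ (fired (P k))
  fires-P zero rewrite ∣⊥∣≡0 n | fired-⊥ = nil
  fires-P (suc k) with P (suc k) | growth k
  ... | _ | stuck _ = fires-P k
  ... | _ | add x b x∉ rewrite ∣insert∣ x (P k) x∉ | ≡-sym (fire-fired (P k) x (P⊑B k) x∉) =
    fires-snoc x (fires-P k) (canFire⁺ (P k) x x∉ b)

  burnOff : Σ (Vec ℕ n) λ D → Relaxed G ⊤ D × Fires G ⊤ X ∣ P n ∣ D
  burnOff = fired (P n) , relaxed⁺ (P n) closed , fires-P n

  burnOff-length : ∀ {ℓ D} → Relaxed G ⊤ D → Fires G ⊤ X ℓ D → ∣ P n ∣ ≡ ℓ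
  burnOff-length {ℓ} {D} rel fs = trans
    (fires-length ⊥ (λ u p → contradiction p (∉⊥ u)) (λ u p → contradiction p (∉⊥ u))
      (subst (λ Y → Fires G ⊤ Y ℓ D) (≡-sym fired-⊥) fs) rel)
    (cong (_+ ℓ) (∣⊥∣≡0 n))

module _ {n : ℕ} (C : Vec ℕ n) (v : Fin n) where

  seed-self : lookup (C [ v ]%= suc) v ≡ suc (lookup C v)
  seed-self = lookup∘updateAt v C

  seed-other : ∀ {u} → u ≢ v → lookup (C [ v ]%= suc) u ≡ lookup C u
  seed-other {u} u≢v = lookup∘updateAt′ u v u≢v C

  seed-≤ : ∀ u → lookup (C [ v ]%= suc) u ≤ suc (lookup C u)
  seed-≤ u with u ≟ v
  ... | yes refl = ≤-reflexive seed-self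
  ... | no u≢v   = m≤n⇒m≤1+n (≤-reflexive (seed-other u≢v))

-- From trees to configurations

-- On the tree, u is given just enough chips to start burning at the step at which
-- it is first touched along an edge of the tree.
configuration : ∀ {n} → Graph n → Fin n → Subset n → Vec (Vec Bool n) n → Vec ℕ n → Vec ℕ n
configuration {n} G v S F D = tabulate λ u →
  if lookup S u
  then (if does (u ≟ v) then deg G ⊤ u else suc (deg G ⊤ u) ∸ deg G (P (lev u)) u)
  else lookup D u
  where open Process (spread F v)

module FromTree {n : ℕ} (G : Graph n) {ℓ : ℕ} {v : Fin n} (S : Subset n) (F : Vec (Vec Bool n) n)
                (T : IsSubtreeAt G ℓ v (S , F)) (D : Vec ℕ n) (rl : RelaxedLegal G (∁ S) D) where
  open Degree G
  open Subtree G {S = S} {F} T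

  C : Vec ℕ n
  C = configuration G v S F D

  X : Vec ℕ n
  X = C [ v ]%= suc

  v∈S : lookup S v ≡ true
  v∈S = P⊑S n v (BP⊑Pn 0 v (v∈P 0))

  lookup-C : ∀ u → lookup C u ≡
    (if lookup S u
     then (if does (u ≟ v) then deg G ⊤ u else suc (deg G ⊤ u) ∸ deg G (P (lev u)) u)
     else lookup D u)
  lookup-C u = lookup∘tabulate _ u

  C-outside : ∀ u → lookup S u ≡ false → lookup C u ≡ lookup D u
  C-outside u u∉ = trans (lookup-C u) at
    where
    at : (if lookup S u
          then (if does (u ≟ v) then deg G ⊤ u else suc (deg G ⊤ u) ∸ deg G (P (lev u)) u)
          else lookup D u) ≡ lookup D u
    at rewrite u∉ = refl

  C-root : lookup C v ≡ deg G ⊤ v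
  C-root = trans (lookup-C v) at
    where
    at : (if lookup S v
          then (if does (v ≟ v) then deg G ⊤ v else suc (deg G ⊤ v) ∸ deg G (P (lev v)) v)
          else lookup D v) ≡ deg G ⊤ v
    at rewrite v∈S | dec-true (v ≟ v) refl = refl

  C-inside : ∀ u → lookup S u ≡ true → u ≢ v → lookup C u ≡ suc (deg G ⊤ u) ∸ deg G (P (lev u)) u
  C-inside u u∈ u≢v = trans (lookup-C u) at
    where
    at : (if lookup S u
          then (if does (u ≟ v) then deg G ⊤ u else suc (deg G ⊤ u) ∸ deg G (P (lev u)) u)
          else lookup D u) ≡ suc (deg G ⊤ u) ∸ deg G (P (lev u)) u
    at rewrite u∈ | dec-false (u ≟ v) u≢v = refl

  D-small : ∀ u → lookup S u ≡ false → lookup D u ≤ deg G (∁ S) u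
  D-small u u∉ = proj₂ (proj₁ rl) u (trans (lookup-∁ S u) (cong not u∉))

  S-touched : ∀ u → lookup S u ≡ true → lookup (spread F v (P (lev u))) u ≡ true
  S-touched u u∈ = lev-holds u (subst (λ Q → lookup Q u ≡ true) (≡-sym Pn≡S) u∈)

  C-small : ∀ u → lookup C u ≤ deg G ⊤ u
  C-small u with lookup S u in u∈?
  ... | false = ≤-trans (≤-reflexive (C-outside u u∈?)) (≤-trans (D-small u u∈?) (deg-≤⊤ (∁ S) u))
  ... | true with u ≟ v
  ...   | yes refl = ≤-reflexive C-root
  ...   | no u≢v with spread⁻ F v (P (lev u)) u (S-touched u u∈?)
  ...     | inj₁ e            = contradiction e u≢v
  -- The touching neighbour `w` makes the subtracted degree at least 1, which absorbs the `suc`.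
  ...     | inj₂ (w , w∈ , e) = ≤-trans (≤-reflexive (C-inside u u∈? u≢v))
    (∸-monoʳ-≤ (suc (deg G ⊤ u)) (≤-trans (s≤s z≤n)
      (deg-< {⊥} {P (lev u)} {w} u (λ x p → contradiction p (∉⊥ x)) w∈
             (lookup-replicate w false) (edge-adj e))))

  -- The threshold is met with no chip to spare. For the root the level is 0, where nothing has
  -- fired, and the seed supplies the one chip above the degree.
  X-inside : ∀ u → lookup S u ≡ true → lookup X u + deg G (P (lev u)) u ≡ suc (deg G ⊤ u)
  X-inside u u∈ with u ≟ v
  ... | yes refl rewrite n≤0⇒n≡0 (lev-≤ v {0} (v∈P 0)) | deg-⊥ v | +-identityʳ (lookup X v) =
    trans (seed-self C v) (cong suc C-root)
  ... | no u≢v = trans (cong (_+ deg G (P (lev u)) u) (trans (seed-other C v u≢v) (C-inside u u∈ u≢v)))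
    (m∸n+n≡m (m≤n⇒m≤1+n (deg-≤⊤ (P (lev u)) u)))

  -- A vertex of `S` not yet touched still lacks the tree neighbour through which it will be, and is
  -- thus at least one chip short. A vertex off `S` stays below its threshold even when all of `S`
  -- has fired, because `D` is relaxed.
  burn≡spread : ∀ k → burn G X (P k) ≡ spread F v (P k)
  burn≡spread k = ⊑-antisym to from
    where
    from : spread F v (P k) ⊑ burn G X (P k)
    from u p = burn⁺ G X (P k) u (≤-trans
      (≤-reflexive (≡-sym (X-inside u (P⊑S n u (BP⊑Pn k u p)))))
      (+-monoʳ-≤ (lookup X u) (deg-mono {P (lev u)} {P k} u (P-mono (lev-≤ u {k} p)))))
    untouched : ∀ u → lookup S u ≡ true → ¬ lookup (spread F v (P k)) u ≡ true →
                lookup X u + deg G (P k) u ≤ deg G ⊤ u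
    untouched u u∈ not-touched with spread⁻ F v (P (lev u)) u (S-touched u u∈)
    ... | inj₁ refl         = contradiction (v∈P k) not-touched
    ... | inj₂ (w , w∈ , e) = ≤-pred (≤-trans
      (≤-reflexive (≡-sym (+-suc (lookup X u) (deg G (P k) u))))
      (≤-trans (+-monoʳ-≤ (lookup X u) (deg-< {P k} {P (lev u)} {w} u
                 (P-mono (<⇒≤ (≰⇒> late))) w∈
                 (¬-not λ q → not-touched (spread⁺ F v {P k} (inj₂ (w , q , e)))) (edge-adj e)))
               (≤-reflexive (X-inside u u∈))))
      where
      late : ¬ lev u ≤ k
      late le = not-touched (B-mono le u (S-touched u u∈))
    to : burn G X (P k) ⊑ spread F v (P k)
    to u p with lookup (spread F v (P k)) u in touched?
    ... | true = refl
    ... | false = contradiction (burn⁻ G X (P k) u p) (≤⇒≯ bound)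
      where
      bound : lookup X u + deg G (P k) u ≤ deg G ⊤ u
      bound with lookup S u in u∈?
      ... | true  = untouched u u∈? λ q → true≢false q touched?
      ... | false = begin
        lookup X u + deg G (P k) u       ≡⟨ cong (_+ deg G (P k) u) (trans (seed-other C v λ { refl → true≢false v∈S u∈? }) (C-outside u u∈?)) ⟩
        lookup D u + deg G (P k) u       ≤⟨ +-mono-≤ (D-small u u∈?) (deg-mono {P k} {S} u (P⊑S k)) ⟩
        deg G (∁ S) u + deg G S u        ≡⟨ +-comm (deg G (∁ S) u) _ ⟩
        deg G S u + deg G (∁ S) u        ≡⟨ deg-split S u ⟨
        deg G ⊤ u                        ∎
        where open ≤-Reasoning

  open Agreement (spread F v) (burn G X) burn≡spread

  fired≡S : Process.P (burn G X) n ≡ S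
  fired≡S = trans (P-agree n) Pn≡S

  burn-tree : Process.tree (burn G X) ≡ F
  burn-tree = trans tree-agree tree≡F

  C-noForbidden : NoForbidden ⊤ C
  C-noForbidden A _ (x , x∈) with search n
    where
    -- The first vertex of A to burn does so without the help of A.
    search : ∀ k → (∀ u → lookup A u ≡ true → lookup (P k) u ≡ false) ⊎
                   ∃ λ u → lookup A u ≡ true × deg G A u ≤ lookup C u
    search zero = inj₁ λ u _ → lookup-replicate u false
    search (suc k) with search k
    ... | inj₂ found = inj₂ found
    ... | inj₁ avoids with any? (λ u → (lookup A u ≟ᵇ true) ×-dec (lookup (P (suc k)) u ≟ᵇ true))
    ...   | no none = inj₁ λ u u∈ → ¬-not λ q → none (u , u∈ , q)
    ...   | yes (u , u∈ , q) with P-suc⁻ k u q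
    ...     | inj₁ r = contradiction (avoids u u∈) (true≢false r)
    ...     | inj₂ r = inj₂ (u , u∈ , ≤-pred (≤-trans (+-cancelˡ-≤ (deg G (P k) u) _ _ (begin
      deg G (P k) u + suc (deg G A u)    ≡⟨ +-suc (deg G (P k) u) _ ⟩
      suc (deg G (P k) u + deg G A u)    ≤⟨ s≤s (deg-disjoint {P k} {A} u avoids) ⟩
      suc (deg G ⊤ u)                    ≤⟨ burn⁻ G X (P k) u (subst (λ Q → lookup Q u ≡ true) (≡-sym (burn≡spread k)) r) ⟩
      lookup X u + deg G (P k) u         ≡⟨ +-comm (lookup X u) _ ⟩
      deg G (P k) u + lookup X u         ∎)) (seed-≤ C v u)))
      where open ≤-Reasoning
  ... | inj₂ found = found
  -- If no vertex of `A` ever burns, `A` lies off `S`, and the legality of `D` provides the vertex.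
  ... | inj₁ avoids with reaches⇒noForbidden (proj₂ (proj₂ rl)) A A⊑∁S (x , x∈)
    where
    A⊑∁S : A ⊑ ∁ S
    A⊑∁S u u∈ = trans (lookup-∁ S u) (cong not (subst (λ Q → lookup Q u ≡ false) Pn≡S (avoids u u∈)))
  ...   | u , u∈ , le = u , u∈ , ≤-trans le (≤-reflexive (≡-sym
    (C-outside u (subst (λ Q → lookup Q u ≡ false) Pn≡S (avoids u u∈)))))

  C-relaxedLegal : RelaxedLegal G ⊤ C
  C-relaxedLegal = (on , λ u _ → C-small u) , noForbidden⇒legal {⊤} {C} on C-noForbidden
    where
    on : OnW G ⊤ C
    on u p = contradiction p (true≢false (∈⊤ u))

  C-burnOffLength : BurnOffLength G C v ℓ
  C-burnOffLength with Game.burnOff G X (λ u → ≤-trans (seed-≤ C v u) (s≤s (C-small u)))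
  ... | E , rel , fires = E , rel , subst (λ k → Fires G ⊤ X k E) size fires
    where
    size : ∣ Process.P (burn G X) n ∣ ≡ ℓ
    size = trans (cong ∣_∣ fired≡S) (proj₁ (proj₂ (proj₂ (proj₂ (proj₂ T)))))

-- Burning the seeded configuration recovers both `S` and `F`, so they are functions of the
-- configuration.
configuration-injective : ∀ {n} (G : Graph n) {ℓ v S F D S′ F′ D′} →
  IsSubtreeAt G ℓ v (S , F) → RelaxedLegal G (∁ S) D →
  IsSubtreeAt G ℓ v (S′ , F′) → RelaxedLegal G (∁ S′) D′ →
  configuration G v S F D ≡ configuration G v S′ F′ D′ → (S , F) ≡ (S′ , F′)
configuration-injective {n} G {v = v} {S} {F} {D} {S′} {F′} {D′} T rl T′ rl′ eq = cong₂ _,_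
  (trans (≡-sym M.fired≡S) (trans (cong (λ C → Process.P (burn G (C [ v ]%= suc)) n) eq) M′.fired≡S))
  (trans (≡-sym M.burn-tree) (trans (cong (λ C → Process.tree (burn G (C [ v ]%= suc))) eq) M′.burn-tree))
  where
  module M  = FromTree G S F T D rl
  module M′ = FromTree G S′ F′ T′ D′ rl′

-- Off `S` the configuration is a copy of `D`; on `S` both candidates vanish by `OnW`.
configuration-injectiveʳ : ∀ {n} (G : Graph n) {ℓ v S F D D′} →
  IsSubtreeAt G ℓ v (S , F) → RelaxedLegal G (∁ S) D → RelaxedLegal G (∁ S) D′ →
  configuration G v S F D ≡ configuration G v S F D′ → D ≡ D′
configuration-injectiveʳ G {S = S} {F} {D} {D′} T rl rl′ eq = lookup-ext at
  where
  at : ∀ u → lookup D u ≡ lookup D′ u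
  at u with lookup S u in u∈?
  ... | false = trans (≡-sym (FromTree.C-outside G S F T D rl u u∈?))
    (trans (cong (λ C → lookup C u) eq) (FromTree.C-outside G S F T D′ rl′ u u∈?))
  ... | true  = trans (proj₁ (proj₁ rl) u u∉∁) (≡-sym (proj₁ (proj₁ rl′) u u∉∁))
    where
    u∉∁ : lookup (∁ S) u ≡ false
    u∉∁ = trans (lookup-∁ S u) (cong not u∈?)

-- From configurations to trees

module FromConfiguration {n : ℕ} (G : Graph n) {ℓ : ℕ} (ℓ>0 : ℓ > 0) {v : Fin n} {C : Vec ℕ n}
                         (rl : RelaxedLegal G ⊤ C) (off : BurnOffLength G C v ℓ) where
  open Degree G

  X : Vec ℕ n
  X = C [ v ]%= suc

  C-small : ∀ u → lookup C u ≤ deg G ⊤ u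
  C-small u = proj₂ (proj₁ rl) u (∈⊤ u)

  bounded : ∀ u → lookup X u ≤ suc (deg G ⊤ u)
  bounded u = ≤-trans (seed-≤ C v u) (s≤s (C-small u))

  open Game G X bounded

  size : ∣ P n ∣ ≡ ℓ
  size = burnOff-length (proj₁ (proj₂ off)) (proj₂ (proj₂ off))

  only-root : ∀ u → lookup (burn G X ⊥) u ≡ true → u ≡ v
  only-root u p with u ≟ v
  ... | yes e  = e
  ... | no u≢v = contradiction (burn⁻ G X ⊥ u p) (≤⇒≯ (≤-trans
    (≤-reflexive (trans (cong₂ _+_ (seed-other C v u≢v) (deg-⊥ u)) (+-identityʳ _))) (C-small u)))

  root : lookup (burn G X ⊥) v ≡ true
  root with lookup (burn G X ⊥) v in eq
  ... | true  = refl
  -- Only `v` can fire first. If it could not, the empty set would be closed and the game would have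
  -- length 0, against `ℓ>0`.
  ... | false = contradiction (trans (≡-sym size) empty) (>⇒≢ ℓ>0)
    where
    closed-⊥ : burn G X ⊥ ⊑ ⊥
    closed-⊥ u p with only-root u p
    ... | refl = contradiction eq (true≢false p)
    empty : ∣ P n ∣ ≡ 0
    empty = trans (cong ∣_∣ (⊑-antisym {P = P n} {⊥} (P-least ⊥ (burn-mono G X) closed-⊥ n)
                                       (λ u p → contradiction p (∉⊥ u)))) (∣⊥∣≡0 n)

  S : Subset n
  S = P n

  F : Vec (Vec Bool n) n
  F = tree

  D : Vec ℕ n
  D = tabulate λ u → if lookup S u then 0 else lookup C u

  spread≡burn : ∀ k → spread F v (P k) ≡ burn G X (P k)
  spread≡burn = spread-tree (burn G X) (burn-mono G X) root only-root

  -- The firing of a nonadjacent `w` would leave the number of fired neighbours of `u` unchanged, so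
  -- `u` would have been able to fire before it.
  parent-adj : ∀ {u w} → Parent u w → adj G u w ≡ true
  parent-adj {u} {w} record { j = j ; w∈ = w∈ ; w∉ = w∉ ; u∈ = u∈ ; u∉ = u∉ }
    with adj G u w in a
  ... | true  = refl
  ... | false = contradiction u∉ (true≢false (burn⁺ G X (P j) u
    (subst (λ d → deg G ⊤ u < lookup X u + d)
      (trans (cong (λ Q → deg G Q u) (P-suc-new j w∈ w∉)) (deg-insert-nonadj {P j} u w∉ a))
      (burn⁻ G X (P (suc j)) u u∈))))

  tree-adj : ∀ u w → Edge F u w → adj G u w ≡ true
  tree-adj u w e with tree-edge (burn G X) (burn-mono G X) root only-root {u} {w} e
  ... | inj₁ p = parent-adj p
  ... | inj₂ p = trans (Graph.sym G u w) (parent-adj p)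

  edge-sym : ∀ {u w} → Edge F u w → Edge F w u
  edge-sym {u} {w} e =
    trans (≡-sym (tree-symmetric (burn G X) (burn-mono G X) root only-root u w)) e

  tree-support : ∀ u w → Edge F u w → lookup S u ≡ true
  tree-support u w = tree-⊑ (burn G X) (burn-mono G X) root only-root {u} {w}

  reach-root : ∀ k u → lookup (P k) u ≡ true → Reach G F u v
  reach-root zero    u p = contradiction p (∉⊥ u)
  reach-root (suc k) u p with P-suc⁻ k u p
  ... | inj₁ q = reach-root k u q
  ... | inj₂ q with spread⁻ F v (P k) u (subst (λ Q → lookup Q u ≡ true) (≡-sym (spread≡burn k)) q)
  ...   | inj₁ refl         = here
  ...   | inj₂ (w , w∈ , e) = there e (reach-root k w w∈)

  reach-trans : ∀ {a b c} → Reach G F a b → Reach G F b c → Reach G F a c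
  reach-trans here        s = s
  reach-trans (there e r) s = there e (reach-trans r s)

  reach-sym : ∀ {a b} → Reach G F a b → Reach G F b a
  reach-sym here              = here
  reach-sym (there {u} {x} e r) = reach-trans (reach-sym r) (there (edge-sym {u} {x} e) here)

  subtree : IsSubtreeAt G ℓ v (S , F)
  subtree =
      (λ u w e → tree-adj u w e , tree-support u w e , tree-support w u (edge-sym {u} {w} e))
    , tree-symmetric (burn G X) (burn-mono G X) root only-root
    , (λ u w u∈ w∈ → reach-trans (reach-root n u u∈) (reach-sym (reach-root n w w∈)))
    , Acyclic.acyclic G F rank (λ {u} {w} → edge-sym {u} {w})
        (λ {u} {w} → tree-distinct (burn G X) (burn-mono G X) root only-root {u} {w})
        (λ {u} {w} {w′} e e′ lt lt′ → parent-unique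
          (tree-lower (burn G X) (burn-mono G X) root only-root {u} {w} e lt)
          (tree-lower (burn G X) (burn-mono G X) root only-root {u} {w′} e′ lt′))
    , size
    , BP⊑Pn 0 v root

  D-outside : ∀ u → lookup S u ≡ false → lookup D u ≡ lookup C u
  D-outside u u∉ = trans (lookup∘tabulate _ u) (cong (λ b → if b then 0 else lookup C u) u∉)

  ∁S⁻ : ∀ u → lookup (∁ S) u ≡ true → lookup S u ≡ false
  ∁S⁻ u p with lookup S u | trans (≡-sym (lookup-∁ S u)) p
  ... | false | _ = refl

  D-relaxedLegal : RelaxedLegal G (∁ S) D
  D-relaxedLegal = (on , small) , noForbidden⇒legal {∁ S} {D} on noForbidden
    where
    on : OnW G (∁ S) D
    on u p with lookup S u in u∈? | trans (≡-sym (lookup-∁ S u)) p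
    ... | true  | _ = trans (lookup∘tabulate _ u) (cong (λ b → if b then 0 else lookup C u) u∈?)
    small : ∀ u → lookup (∁ S) u ≡ true → lookup D u ≤ deg G (∁ S) u
    small u p = ≤-trans (≤-reflexive (D-outside u u∉)) (+-cancelˡ-≤ (deg G S u) _ _ (begin
      deg G S u + lookup C u      ≡⟨ +-comm (deg G S u) _ ⟩
      lookup C u + deg G S u      ≡⟨ cong (_+ deg G S u) (seed-other C v u≢v) ⟨
      -- `S` is closed under burning, so `u` cannot fire even after all of `S` has.
      lookup X u + deg G S u      ≤⟨ ≮⇒≥ (λ lt → true≢false (closed u (burn⁺ G X S u lt)) u∉) ⟩
      deg G ⊤ u                   ≡⟨ deg-split S u ⟩
      deg G S u + deg G (∁ S) u   ∎))
      where
      open ≤-Reasoning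
      u∉ = ∁S⁻ u p
      u≢v : u ≢ v
      u≢v refl = true≢false (BP⊑Pn 0 v root) u∉
    noForbidden : NoForbidden (∁ S) D
    noForbidden A A⊑∁S some with reaches⇒noForbidden (proj₂ (proj₂ rl)) A (λ u _ → ∈⊤ u) some
    ... | u , u∈ , le = u , u∈ , ≤-trans le (≤-reflexive (≡-sym (D-outside u (∁S⁻ u (A⊑∁S u u∈)))))

  open Agreement (burn G X) (spread F v) spread≡burn

  -- Just before its parent fires, `u` is at most at its degree, and that single firing adds at most
  -- one chip. For the root the bound on seeded chips takes the place of this argument.
  X-exact : ∀ u → lookup S u ≡ true → lookup X u + deg G (P (lev u)) u ≡ suc (deg G ⊤ u)
  X-exact u u∈ = ≤-antisym upper (burn⁻ G X (P (lev u)) u (lev-holds u u∈))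
    where
    upper : lookup X u + deg G (P (lev u)) u ≤ suc (deg G ⊤ u)
    upper with find-parent {lev u} (lev-holds u u∈)
    ... | inj₁ q rewrite n≤0⇒n≡0 (lev-≤ u {0} q) | deg-⊥ u | +-identityʳ (lookup X u) = bounded u
    ... | inj₂ (w , _ , p) rewrite lev-parent p | P-suc-new (Parent.j p) (Parent.w∈ p) (Parent.w∉ p) =
      ≤-trans (+-monoʳ-≤ (lookup X u) (deg-insert-≤ {P (Parent.j p)} u (Parent.w∉ p)))
        (≤-trans (≤-reflexive (+-suc (lookup X u) _))
          (s≤s (≮⇒≥ λ lt → true≢false (burn⁺ G X (P (Parent.j p)) u lt) (Parent.u∉ p))))

  C≡configuration : C ≡ configuration G v S F D
  C≡configuration = lookup-ext λ u → ≡-sym (trans (lookup∘tabulate _ u) (at u))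
    where
    module Y = Process (spread F v)
    at : ∀ u → (if lookup S u
                then (if does (u ≟ v) then deg G ⊤ u else suc (deg G ⊤ u) ∸ deg G (Y.P (Y.lev u)) u)
                else lookup D u) ≡ lookup C u
    at u with lookup S u in u∈?
    ... | false = D-outside u u∈?
    ... | true rewrite lev-agree u | P-agree (lev u) with X-exact u u∈? | u ≟ v
    ...   | exact | no u≢v = trans (cong (_∸ deg G (P (lev u)) u) (≡-sym exact))
      (trans (m+n∸n≡m (lookup X u) (deg G (P (lev u)) u)) (seed-other C v u≢v))
    -- The seeded root fires with no help, so `C` has at least the degree at `v`; relaxedness gives
    -- the other inequality.
    ...   | exact | yes refl = ≤-antisym
      (≤-pred (≤-trans (subst (deg G ⊤ v <_) (trans (cong (lookup X v +_) (deg-⊥ v)) (+-identityʳ _))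
                              (burn⁻ G X ⊥ v root))
                       (seed-≤ C v v)))
      (C-small v)

-- Counting

module _ {A B : Set} where

  unique-map : ∀ (f : A → B) {xs} → (∀ {x y} → x ∈ xs → y ∈ xs → f x ≡ f y → x ≡ y) →
               Unique xs → Unique (map f xs)
  unique-map f {[]}     inj []        = []
  unique-map f {x ∷ xs} inj (x∉ ∷ u) =
    All-map⁺ (All.tabulate λ y∈ eq → All.lookup x∉ y∈ (inj (here refl) (there y∈) eq))
    ∷ unique-map f (λ a b → inj (there a) (there b)) u

  ∈-concatMap : ∀ (f : A → List B) {xs z} → z ∈ concatMap f xs → ∃ λ x → x ∈ xs × z ∈ f x
  ∈-concatMap f z∈ = find (∈-concatMap⁻ f z∈)

  unique-concatMap : ∀ (f : A → List B) {xs} → (∀ {x} → x ∈ xs → Unique (f x)) →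
    (∀ {x y z} → x ∈ xs → y ∈ xs → z ∈ f x → z ∈ f y → x ≡ y) →
    Unique xs → Unique (concatMap f xs)
  unique-concatMap f {[]}     each sep []       = []
  unique-concatMap f {x ∷ xs} each sep (x∉ ∷ u) = unique-++⁺ (each (here refl))
    (unique-concatMap f (each ∘ there) (λ a b → sep (there a) (there b)) u)
    λ (p , q) → let y , y∈ , r = ∈-concatMap f q in
                All.lookup x∉ y∈ (sep (here refl) (there y∈) p r)

  length-concatMap : ∀ (f : A → List B) xs → length (concatMap f xs) ≡ sum (map (length ∘ f) xs)
  length-concatMap f []       = refl
  length-concatMap f (x ∷ xs) = trans (length-++ (f x)) (cong (length (f x) +_) (length-concatMap f xs))

theorem4p2 : (n : ℕ) (G : Graph n) (ℓ : ℕ) → ℓ > 0 →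
    (r : Subset n → ℕ) → (∀ W → HasSize (RelaxedLegal G W) (r W)) →
    (ts : Fin n → List (SubgraphData G)) →
    (∀ v → Enumerates (IsSubtreeAt G ℓ v) (ts v)) →
    HasSize {Vec ℕ n × Fin n}
    (λ { (C , v) → RelaxedLegal G ⊤ C × BurnOffLength G C v ℓ })
    (sum (map (λ v → sum (map (λ T → r (∁ (proj₁ T))) (ts v))) (allFin n)))
theorem4p2 n G ℓ ℓ>0 r sizes ts trees =
  -- The list is nested over `v`, the subtree and the configuration off it, so its length is the
  -- double sum once the pieces are known to be disjoint.
  concatMap pairsAt (allFin n) , (unique , λ { (C , v) → mk⇔ (λ { (rl , off) → complete rl off }) sound }) , count
  where
  ds : Subset n → List (Vec ℕ n)
  ds W = proj₁ (sizes W)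

  d-legal : ∀ {W D} → D ∈ ds W → RelaxedLegal G W D
  d-legal {W} {D} = Equivalence.from (proj₂ (proj₁ (proj₂ (sizes W))) D)

  t-subtree : ∀ {v T} → T ∈ ts v → IsSubtreeAt G ℓ v T
  t-subtree {v} {T} = Equivalence.from (proj₂ (trees v) T)

  pair : Fin n → SubgraphData G → Vec ℕ n → Vec ℕ n × Fin n
  pair v (S , F) D = configuration G v S F D , v

  pairsOn : Fin n → SubgraphData G → List (Vec ℕ n × Fin n)
  pairsOn v T = map (pair v T) (ds (∁ (proj₁ T)))

  pairsAt : Fin n → List (Vec ℕ n × Fin n)
  pairsAt v = concatMap (pairsOn v) (ts v)

  pairsOn⁻ : ∀ {v T z} → z ∈ pairsOn v T → ∃ λ D → RelaxedLegal G (∁ (proj₁ T)) D × z ≡ pair v T D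
  pairsOn⁻ {v} {T} z∈ with ∈-map⁻ (pair v T) z∈
  ... | D , D∈ , eq = D , d-legal D∈ , eq

  pairsAt-vertex : ∀ {v z} → z ∈ pairsAt v → proj₂ z ≡ v
  pairsAt-vertex {v} z∈ with ∈-concatMap (pairsOn v) {ts v} z∈
  ... | T , _ , q with pairsOn⁻ {v} {T} q
  ...   | _ , _ , refl = refl

  pairsOn-separate : ∀ {v T T′ z} → T ∈ ts v → T′ ∈ ts v → z ∈ pairsOn v T → z ∈ pairsOn v T′ → T ≡ T′
  pairsOn-separate {v} {T} {T′} T∈ T′∈ p q with pairsOn⁻ {v} {T} p | pairsOn⁻ {v} {T′} q
  ... | D , rl , refl | D′ , rl′ , eq =
    configuration-injective G (t-subtree T∈) rl (t-subtree T′∈) rl′ (cong proj₁ eq)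

  unique : Unique (concatMap pairsAt (allFin n))
  unique = unique-concatMap pairsAt
    (λ {v} _ → unique-concatMap (pairsOn v)
      (λ {T} T∈ → unique-map (pair v T)
        (λ D∈ D′∈ eq → configuration-injectiveʳ G (t-subtree T∈) (d-legal D∈) (d-legal D′∈) (cong proj₁ eq))
        (proj₁ (proj₁ (proj₂ (sizes (∁ (proj₁ T)))))))
      pairsOn-separate
      (proj₁ (trees v)))
    (λ {u} {v} _ _ p q → trans (≡-sym (pairsAt-vertex {u} p)) (pairsAt-vertex {v} q))
    (allFin⁺ n)

  complete : ∀ {C v} → RelaxedLegal G ⊤ C → BurnOffLength G C v ℓ →
             (C , v) ∈ concatMap pairsAt (allFin n)
  complete {C} {v} rl off = ∈-concatMap⁺ pairsAt (lose (∈-allFin v)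
    (∈-concatMap⁺ (pairsOn v) (lose (Equivalence.to (proj₂ (trees v) (S , F)) subtree)
      (subst (λ C′ → (C′ , v) ∈ pairsOn v (S , F)) (≡-sym C≡configuration)
        (∈-map⁺ (pair v (S , F)) (Equivalence.to (proj₂ (proj₁ (proj₂ (sizes (∁ S)))) D) D-relaxedLegal))))))
    where open FromConfiguration G ℓ>0 rl off

  sound : ∀ {C v} → (C , v) ∈ concatMap pairsAt (allFin n) → RelaxedLegal G ⊤ C × BurnOffLength G C v ℓ
  sound z∈ with ∈-concatMap pairsAt {allFin n} z∈
  ... | v , _ , p with ∈-concatMap (pairsOn v) {ts v} p
  ...   | T@(S , F) , T∈ , q with pairsOn⁻ {v} {T} q
  ...     | D , rl , refl = C-relaxedLegal , C-burnOffLength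
    where open FromTree G S F (t-subtree {v} T∈) D rl

  count : length (concatMap pairsAt (allFin n)) ≡
          sum (map (λ v → sum (map (λ T → r (∁ (proj₁ T))) (ts v))) (allFin n))
  count = trans (length-concatMap pairsAt (allFin n)) (cong sum (map-cong
    (λ v → trans (length-concatMap (pairsOn v) (ts v)) (cong sum (map-cong
      (λ T → trans (length-map (pair v T) (ds (∁ (proj₁ T)))) (proj₂ (proj₂ (sizes (∁ (proj₁ T))))))
      (ts v))))
    (allFin n)))
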